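{- Let $\mathcal{F}:\mathcal{M}\to\Omega$ be a Fitting invariant. Then for any $n\ge0$, the following map $\mathcal{F}^{[n]}:\mathcal{M}\to\Omega$ is well-defined: for each $M\in\mathcal{M}$, take an exact sequence \[ 0\to N\to P_1\to\dots\to P_n\to M\to0 \] in $\mathcal{M}$ with $P_1,\dots,P_n\in\mathcal{P}$ and define \[ \mathcal{F}^{[n]}(M)=\left(\prod_{i=1}^n\mathcal{F}(P_i)^{(-1)^i}\right)\mathcal{F}(N). \] Moreover, $\mathcal{F}^{[n]}:\mathcal{M}\to\Omega$ is again a Fitting invariant.
   Context: $R$ is a (not necessarily commutative) ring with unity which is left and right noetherian, and $S$ is an Ore set of $R$ consisting of non-zero-divisors: $1\in S$; $S$ is closed under multiplication; and for $f\in S$, $a\in R$ one has $fR\cap aS\ne\emptyset$ and $Rf\cap Sa\ne\emptyset$. A left $R$-module is $S$-torsion if each of its elements is annihilated by an element of $S$. $\mathcal M$ is the category of finitely generated $S$-torsion left $R$-modules and $\mathcal P=\{P\in\mathcal M\mid\mathrm{pd}_R(P)\le1\}$, with $\mathrm{pd}_R$ the projective dimension (the zero module has $\mathrm{pd}_R=-\infty$). A Fitting invariant is a map $\mathcal F$ assigning to each object of $\mathcal M$ an element of a commutative monoid $\Omega$ such that: (i) $\mathcal F(P)\in\Omega^\times$ for $P\in\mathcal P$; (ii) if $0\to M'\to M\to P\to0$ is exact in $\mathcal M$ with $P\in\mathcal P$, then $\mathcal F(M)=\mathcal F(P)\mathcal F(M')$. "Well-defined" means that such an exact sequence exists for each $M$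 and that the value does not depend on its choice. -}

module Defs where

open import Level using (Level; _⊔_) renaming (suc to lsuc)
open import Data.Nat.Base using (ℕ; zero; suc)
open import Data.Fin.Base using (Fin; toℕ)
open import Data.Integer.Base using (ℤ; +_; -[1+_]; -1ℤ) renaming (_^_ to _^ᶻ_)
open import Data.Vec.Functional using (Vector; []; _∷_; head; tail)
open import Data.Product.Base using (Σ; Σ-syntax; ∃-syntax; _×_; _,_; proj₁; proj₂)
open import Function.Base using (_∘_)
open import Function.Bundles using (_⇔_)
import Function.Definitions as FunDefs
open import Relation.Unary using (Pred; _∈_; U)
open import Relation.Binary.Definitions using (_Respects_)
open import Algebra.Bundles using (Ring; CommutativeMonoid)
import Algebra.Construct.Flip.Op as Op
import Algebra.Definitions
import Algebra.Definitions.RawMonoid as RawMonoidDefs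
import Algebra.Properties.Group
open import Algebra.Module.Bundles using (LeftModule)
import Algebra.Module.Construct.TensorUnit as TensorUnit
import Algebra.Module.Construct.Zero as Zero
open import Algebra.Module.Morphism.Structures using (module LeftModuleMorphisms)

-- The ring (carrier and equality), all modules over it, and all ideals and
-- subsets of it live in a single universe u.

module _ {u : Level} {R : Ring u u} (M : LeftModule R u u) where
  private module R = Ring R
  open LeftModule M

  record IsSubmodule (N : Pred Carrierᴹ u) : Set u where
    field
      ∈-resp-≈ : N Respects _≈ᴹ_
      0∈       : 0ᴹ ∈ N
      +-closed : ∀ {x y} → x ∈ N → y ∈ N → (x +ᴹ y) ∈ N
      *-closed : ∀ r {x} → x ∈ N → (r *ₗ x) ∈ N

  linComb : ∀ {k} → Vector R.Carrier k → Vector Carrierᴹ k → Carrierᴹ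
  linComb c g = RawMonoidDefs.sum +ᴹ-rawMonoid (λ i → c i *ₗ g i)

  FinitelyGeneratedSub : ∀ {p} → Pred Carrierᴹ p → Set (u ⊔ p)
  FinitelyGeneratedSub N =
    ∃[ k ] Σ[ g ∈ Vector Carrierᴹ k ]
      (∀ i → g i ∈ N) × (∀ x → x ∈ N → ∃[ c ] x ≈ᴹ linComb c g)

  FinitelyGenerated : Set u
  FinitelyGenerated = FinitelyGeneratedSub U

  IsTorsion : Pred R.Carrier u → Set u
  IsTorsion S = ∀ x → ∃[ s ] s ∈ S × s *ₗ x ≈ᴹ 0ᴹ

LeftNoetherian : ∀ {u} → Ring u u → Set (lsuc u)
LeftNoetherian {u} R =
  ∀ (I : Pred (Ring.Carrier R) u) → IsSubmodule ᵣR I → FinitelyGeneratedSub ᵣR I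
  where ᵣR = TensorUnit.leftModule {R = R}

-- Right ideals of R are left ideals of the opposite ring.
RightNoetherian : ∀ {u} → Ring u u → Set (lsuc u)
RightNoetherian R = LeftNoetherian (Op.ring R)

module _ {u : Level} (R : Ring u u) where
  open Ring R

  record IsOreSet (S : Pred Carrier u) : Set u where
    field
      ∈-resp-≈       : S Respects _≈_
      1∈S            : 1# ∈ S
      *-closed       : ∀ {s t} → s ∈ S → t ∈ S → (s * t) ∈ S
      left-regular   : ∀ {s} → s ∈ S → ∀ x → s * x ≈ 0# → x ≈ 0#
      right-regular  : ∀ {s} → s ∈ S → ∀ x → x * s ≈ 0# → x ≈ 0#
      fR∩aS-nonempty : ∀ {f} → f ∈ S → ∀ a → ∃[ r ] ∃[ s ] s ∈ S × f * r ≈ a * s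
      Rf∩Sa-nonempty : ∀ {f} → f ∈ S → ∀ a → ∃[ r ] ∃[ s ] s ∈ S × r * f ≈ s * a

module _ {u : Level} {R : Ring u u} where

  private
    Mod : Set (lsuc u)
    Mod = LeftModule R u u

  record Hom (A B : Mod) : Set u where
    private
      module A = LeftModule A
      module B = LeftModule B
    field
      ⟦_⟧ : A.Carrierᴹ → B.Carrierᴹ
      isLeftModuleHomomorphism :
        LeftModuleMorphisms.IsLeftModuleHomomorphism A.rawLeftModule B.rawLeftModule ⟦_⟧

  open Hom using (⟦_⟧)

  module _ {A B : Mod} (f : Hom A B) where
    private
      module A = LeftModule A
      module B = LeftModule B

    IsSurjective : Set u
    IsSurjective = FunDefs.Surjective A._≈ᴹ_ B._≈ᴹ_ (⟦ f ⟧)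

    ExactAt : {C : Mod} → Hom B C → Set u
    ExactAt {C} g = ∀ y → (⟦ g ⟧ y C.≈ᴹ C.0ᴹ) ⇔ (∃[ x ] ⟦ f ⟧ x B.≈ᴹ y)
      where module C = LeftModule C

  0Mod : Mod
  0Mod = Zero.leftModule

  fromZero : (A : Mod) → Hom 0Mod A
  fromZero A = record
    { ⟦_⟧ = λ _ → A.0ᴹ
    ; isLeftModuleHomomorphism = record
      { +ᴹ-isGroupHomomorphism = record
        { isMonoidHomomorphism = record
          { isMagmaHomomorphism = record
            { isRelHomomorphism = record { cong = λ _ → A.≈ᴹ-refl }
            ; homo = λ _ _ → A.≈ᴹ-sym (A.+ᴹ-identityˡ A.0ᴹ)
            }
          ; ε-homo = A.≈ᴹ-refl
          }
        ; ⁻¹-homo = λ _ → A.≈ᴹ-sym (Algebra.Properties.Group.ε⁻¹≈ε A.+ᴹ-group)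
        }
      ; *ₗ-homo = λ r _ → A.≈ᴹ-sym (A.*ₗ-zeroʳ r)
      }
    }
    where module A = LeftModule A

  -- Given f : A → B, continuations B → P₁ → … → Pₙ → M → 0 of f such that
  -- the resulting sequence is exact at B, P₁, …, Pₙ and M.
  ExactFrom : ∀ {n} {A B : Mod} → Hom A B → Vector Mod n → Mod → Set u
  ExactFrom {zero}  {B = B} f P M =
    Σ[ g ∈ Hom B M ] ExactAt f g × IsSurjective g
  ExactFrom {suc n} {B = B} f P M =
    Σ[ g ∈ Hom B (head P) ] ExactAt f g × ExactFrom g (tail P) M

  -- Exact sequences 0 → N → P₁ → … → Pₙ → M → 0.
  ExactSequence : ∀ {n} → Mod → Vector Mod n → Mod → Set u
  ExactSequence N P M = ExactFrom (fromZero N) P M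

  ShortExact : Mod → Mod → Mod → Set u
  ShortExact A B C = ExactSequence A (B ∷ []) C

  Projective : Mod → Set (lsuc u)
  Projective Q =
    ∀ {A B : Mod} (g : Hom A B) → IsSurjective g → (f : Hom Q B) →
    Σ[ h ∈ Hom Q A ] (∀ x → LeftModule._≈ᴹ_ B (⟦ g ⟧ (⟦ h ⟧ x)) (⟦ f ⟧ x))

  -- pd M ≤ d: there is a projective resolution
  -- 0 → Q → Q₁ → … → Q_d → M → 0.  The zero module satisfies this for all d.
  ProjDim≤ : ℕ → Mod → Set (lsuc u)
  ProjDim≤ d M =
    Σ[ Q ∈ Mod ] Σ[ Qs ∈ Vector Mod d ]
      Projective Q × (∀ i → Projective (Qs i)) × ExactSequence Q Qs M

module _ {u : Level} (R : Ring u u) (S : Pred (Ring.Carrier R) u) where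

  -- The objects of the category ℳ.
  record Obj : Set (lsuc u) where
    field
      mod     : LeftModule R u u
      fg      : FinitelyGenerated mod
      torsion : IsTorsion mod S

  open Obj using (mod)

  In𝒫 : Obj → Set (lsuc u)
  In𝒫 P = ProjDim≤ 1 (mod P)

  record Resolution (n : ℕ) (M : Obj) : Set (lsuc u) where
    field
      N     : Obj
      P     : Vector Obj n
      P∈𝒫   : ∀ i → In𝒫 (P i)
      exact : ExactSequence (mod N) (mod ∘ P) (mod M)

  module _ {a b : Level} (Ω : CommutativeMonoid a b) where
    open CommutativeMonoid Ω
    open Algebra.Definitions _≈_ using (Invertible)

    IsUnit : Carrier → Set (a ⊔ b)
    IsUnit = Invertible ε _∙_

    record IsFittingInvariant (F : Obj → Carrier) : Set (lsuc u ⊔ a ⊔ b) where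
      field
        unit     : ∀ P → In𝒫 P → IsUnit (F P)
        additive : ∀ {M′ M P} → ShortExact (mod M′) (mod M) (mod P) → In𝒫 P →
                   F M ≈ F P ∙ F M′

    -- The library writes monoids additively there: k × x is the k-fold
    -- product of x, and sum is the product of a finite family.
    private
      open RawMonoidDefs rawMonoid using () renaming (_×_ to _times_; sum to ∏)

    unitPower : (x : Carrier) → IsUnit x → ℤ → Carrier
    unitPower x _         (+ k)    = k times x
    unitPower x (x⁻¹ , _) -[1+ k ] = suc k times x⁻¹

    module _ (F : Obj → Carrier) (isFitting : IsFittingInvariant F) where
      open IsFittingInvariant isFitting

      -- Indices start at 0 here, so P i is the (i+1)-st term of the resolution.
      value : ∀ {n M} → Resolution n M → Carrier
      value ρ =
        ∏ (λ i → unitPower (F (P i)) (unit (P i) (P∈𝒫 i)) (-1ℤ ^ᶻ suc (toℕ i))) ∙ F N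
        where open Resolution ρ

      record WellDefined (n : ℕ) : Set (lsuc u ⊔ b) where
        field
          resolution  : ∀ M → Resolution n M
          independent : ∀ {M} (ρ σ : Resolution n M) → value ρ ≈ value σ

      shift : ∀ n → WellDefined n → Obj → Carrier
      shift n wd M = value (WellDefined.resolution wd M)

{-# OPTIONS --safe #-}
module Submission where

open import Defs
open import Level using (Level; _⊔_) renaming (suc to lsuc)
open import Data.Nat.Base using (ℕ; zero; suc; _+_)
open import Data.Fin.Base using (Fin; zero; suc; toℕ; splitAt)
open import Data.Integer.Base as ℤ using (ℤ; +_; -[1+_]; -1ℤ)
import Data.Integer.Properties as ℤ
open import Data.Unit.Polymorphic.Base using (tt)
open import Data.Vec.Functional using (Vector; []; _∷_; _++_; head; tail)
open import Data.Sum.Base using (inj₁; inj₂)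
open import Data.Product.Base using (Σ; Σ-syntax; ∃-syntax; _×_; _,_; proj₁; proj₂)
open import Function.Base using (_∘_)
open import Function.Bundles using (mk⇔; module Equivalence)
open import Relation.Binary.PropositionalEquality.Core as ≡ using (_≡_)
open import Relation.Unary using (Pred; _∈_; _⊆_; _∩_)
open import Algebra.Bundles using (Ring; CommutativeMonoid)
open import Algebra.Module.Bundles using (LeftModule)
open import Algebra.Module.Morphism.Structures using (module LeftModuleMorphisms)
import Algebra.Module.Construct.DirectProduct as DirectProduct
import Algebra.Module.Construct.TensorUnit as TensorUnit
import Algebra.Properties.AbelianGroup as AbelianGroupProperties
import Algebra.Properties.CommutativeSemigroup as CommutativeSemigroupProperties
import Algebra.Properties.Monoid.Mult as MonoidMult
import Algebra.Properties.Monoid.Sum as MonoidSum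
import Relation.Binary.Reasoning.Setoid as SetoidReasoning

-- Let F¹(M) = F(P)⁻¹ F(N) for one chosen sequence 0 → N → P → M → 0 with P ∈ 𝒫; such a P is
-- built as a finite sum of modules R/Rs with s ∈ S.  For two such sequences the pullback of the
-- two covers of M is an extension of each P by the other N, so F¹ does not depend on the
-- choice.  Given 0 → M′ → M → P → 0 and 0 → N → Q → M → 0, the pullback K of Q → M ← M′ is the
-- kernel of Q → P, hence in 𝒫, and it covers M′ with kernel N; this makes F¹ additive.  The
-- value of F on a resolution of length n + 1 is the value of F¹ on the resolution of length n
-- starting from the cokernel of N → P₁, since F¹ inverts F on 𝒫.  So F^[n+1] = (F¹)^[n],
-- and induction on n, over all Fitting invariants at once, finishes the proof.

-- `Ω` is only a commutative monoid, so a factor can be cancelled only if it is a value on 𝒫. This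
-- shapes the argument: independence of the cover is kept in the multiplied form F(P) F¹(M) = F(N),
-- and additivity of F¹ is reached by cancelling F(K) and F(P). Hence everything turns on K ∈ 𝒫,
-- which is the one place where projective dimension at most one is used through more than the
-- axioms of a Fitting invariant and the choice of covers; the tool is Schanuel's comparison of
-- syzygies. The modules R/Rs serve for covers because a generator of M killed by s is the image of
-- 1 under a map from R/Rs, while right multiplication by the non-zero-divisor s resolves R/Rs by
-- two copies of R. The signs also work out by themselves: cutting off P₁ lowers each remaining
-- index by one and so inverts each exponent, and replacing F by F¹ inverts the bases.

open Hom using (⟦_⟧)
open LeftModule using (Carrierᴹ)

-- `splitAt (suc k) (suc i)` is a map over `splitAt k i`, so the two sides agree only after a case
-- split, pointwise.
tail-++ : ∀ {a} {A : Set a} {k l} (xs : Vector A (suc k)) (ys : Vector A l) i →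
          tail (xs ++ ys) i ≡ (tail xs ++ ys) i
tail-++ {k = k} xs ys i with splitAt k i
... | inj₁ _ = ≡.refl
... | inj₂ _ = ≡.refl

-- Module homomorphisms.

module GroupOf {u : Level} {R : Ring u u} (M : LeftModule R u u) =
  AbelianGroupProperties (LeftModule.+ᴹ-abelianGroup M)

module InterchangeOf {u : Level} {R : Ring u u} (M : LeftModule R u u) =
  CommutativeSemigroupProperties
    (CommutativeMonoid.commutativeSemigroup (LeftModule.+ᴹ-commutativeMonoid M))

module HomProperties {u : Level} {R : Ring u u} {A B : LeftModule R u u} (f : Hom A B) where
  private
    module A = LeftModule A
    module B = LeftModule B

  open LeftModuleMorphisms.IsLeftModuleHomomorphism (Hom.isLeftModuleHomomorphism f) public
    using (⟦⟧-cong; +ᴹ-homo; 0ᴹ-homo; -ᴹ-homo; *ₗ-homo)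

  -homo : ∀ x y → ⟦ f ⟧ (x A.+ᴹ (A.-ᴹ y)) B.≈ᴹ (⟦ f ⟧ x B.+ᴹ (B.-ᴹ ⟦ f ⟧ y))
  -homo x y = B.≈ᴹ-trans (+ᴹ-homo x (A.-ᴹ y)) (B.+ᴹ-congˡ (-ᴹ-homo y))

  0-cong : ∀ {x} → x A.≈ᴹ A.0ᴹ → ⟦ f ⟧ x B.≈ᴹ B.0ᴹ
  0-cong x≈0 = B.≈ᴹ-trans (⟦⟧-cong x≈0) 0ᴹ-homo

module _ {u : Level} {R : Ring u u} where
  private
    module R = Ring R
    Mod : Set (lsuc u)
    Mod = LeftModule R u u

  module _ {A B : Mod} where
    private
      module A = LeftModule A
      module B = LeftModule B

    -- Zero is preserved because it is the multiple by the scalar 0, and negatives because inverses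
    -- are unique; the remaining laws suffice.
    mkHom : (f : A.Carrierᴹ → B.Carrierᴹ) →
            (∀ {x y} → x A.≈ᴹ y → f x B.≈ᴹ f y) →
            (∀ x y → f (x A.+ᴹ y) B.≈ᴹ (f x B.+ᴹ f y)) →
            (∀ r x → f (r A.*ₗ x) B.≈ᴹ (r B.*ₗ f x)) →
            Hom A B
    mkHom f f-cong f-+ f-* = record
      { ⟦_⟧ = f
      ; isLeftModuleHomomorphism = record
        { +ᴹ-isGroupHomomorphism = record
          { isMonoidHomomorphism = record
            { isMagmaHomomorphism = record
              { isRelHomomorphism = record { cong = f-cong }
              ; homo = f-+
              }
            ; ε-homo = f-0
            }
          ; ⁻¹-homo = λ x → GroupOf.inverseˡ-unique B (f (A.-ᴹ x)) (f x)
              (B.≈ᴹ-trans (B.≈ᴹ-sym (f-+ (A.-ᴹ x) x))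
                (B.≈ᴹ-trans (f-cong (A.-ᴹ‿inverseˡ x)) f-0))
          }
        ; *ₗ-homo = f-*
        }
      }
      where
      f-0 : f A.0ᴹ B.≈ᴹ B.0ᴹ
      f-0 = B.≈ᴹ-trans (f-cong (A.≈ᴹ-sym (A.*ₗ-zeroˡ A.0ᴹ)))
              (B.≈ᴹ-trans (f-* R.0# A.0ᴹ) (B.*ₗ-zeroˡ (f A.0ᴹ)))

  idHom : (A : Mod) → Hom A A
  idHom A = mkHom (λ x → x) (λ x≈y → x≈y) (λ _ _ → A.≈ᴹ-refl) (λ _ _ → A.≈ᴹ-refl)
    where module A = LeftModule A

  infixr 9 _∘ₕ_
  _∘ₕ_ : {A B C : Mod} → Hom B C → Hom A B → Hom A C
  _∘ₕ_ {C = C} g f = mkHom (⟦ g ⟧ ∘ ⟦ f ⟧)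
    (G.⟦⟧-cong ∘ F.⟦⟧-cong)
    (λ x y → C.≈ᴹ-trans (G.⟦⟧-cong (F.+ᴹ-homo x y)) (G.+ᴹ-homo _ _))
    (λ r x → C.≈ᴹ-trans (G.⟦⟧-cong (F.*ₗ-homo r x)) (G.*ₗ-homo r _))
    where
    module C = LeftModule C
    module F = HomProperties f
    module G = HomProperties g

  zeroHom : (A B : Mod) → Hom A B
  zeroHom A B = mkHom (λ _ → B.0ᴹ) (λ _ → B.≈ᴹ-refl)
    (λ _ _ → B.≈ᴹ-sym (B.+ᴹ-identityˡ B.0ᴹ)) (λ r _ → B.≈ᴹ-sym (B.*ₗ-zeroʳ r))
    where module B = LeftModule B

  infixl 6 _+ₕ_
  _+ₕ_ : {A B : Mod} → Hom A B → Hom A B → Hom A B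
  _+ₕ_ {B = B} f g = mkHom (λ x → ⟦ f ⟧ x B.+ᴹ ⟦ g ⟧ x)
    (λ x≈y → B.+ᴹ-cong (F.⟦⟧-cong x≈y) (G.⟦⟧-cong x≈y))
    (λ x y → B.≈ᴹ-trans (B.+ᴹ-cong (F.+ᴹ-homo x y) (G.+ᴹ-homo x y))
                        (InterchangeOf.interchange B _ _ _ _))
    (λ r x → B.≈ᴹ-trans (B.+ᴹ-cong (F.*ₗ-homo r x) (G.*ₗ-homo r x))
                        (B.≈ᴹ-sym (B.*ₗ-distribˡ r _ _)))
    where
    module B = LeftModule B
    module F = HomProperties f
    module G = HomProperties g

  -ₕ_ : {A B : Mod} → Hom A B → Hom A B
  -ₕ_ {B = B} f = mkHom (λ x → B.-ᴹ ⟦ f ⟧ x)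
    (B.-ᴹ‿cong ∘ F.⟦⟧-cong)
    (λ x y → B.≈ᴹ-trans (B.-ᴹ‿cong (F.+ᴹ-homo x y))
                        (B.≈ᴹ-sym (GroupOf.⁻¹-∙-comm B _ _)))
    (λ r x → B.≈ᴹ-trans (B.-ᴹ‿cong (F.*ₗ-homo r x)) (-‿*ₗ r (⟦ f ⟧ x)))
    where
    module B = LeftModule B
    module F = HomProperties f
    -‿*ₗ : ∀ r x → B._≈ᴹ_ (B.-ᴹ (r B.*ₗ x)) (r B.*ₗ (B.-ᴹ x))
    -‿*ₗ r x = B.≈ᴹ-sym (GroupOf.inverseˡ-unique B _ _
      (B.≈ᴹ-trans (B.≈ᴹ-sym (B.*ₗ-distribˡ r _ _))
        (B.≈ᴹ-trans (B.*ₗ-congˡ (B.-ᴹ‿inverseˡ x)) (B.*ₗ-zeroʳ r))))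

  IsInjective : {A B : Mod} → Hom A B → Set u
  IsInjective {A} {B} f = ∀ x → ⟦ f ⟧ x B.≈ᴹ B.0ᴹ → x A.≈ᴹ A.0ᴹ
    where
    module A = LeftModule A
    module B = LeftModule B

  -- `IsSurjective` also quantifies over everything equal to the preimage; congruence of `f`
  -- recovers that from this simpler form.
  IsOnto : {A B : Mod} → Hom A B → Set u
  IsOnto {A} {B} f = ∀ y → ∃[ x ] ⟦ f ⟧ x B.≈ᴹ y
    where module B = LeftModule B

  injective-cancel : {A B : Mod} (f : Hom A B) → IsInjective f →
                     ∀ {x y} → LeftModule._≈ᴹ_ B (⟦ f ⟧ x) (⟦ f ⟧ y) → LeftModule._≈ᴹ_ A x y
  injective-cancel {A} {B} f inj {x} {y} fx≈fy =
    GroupOf.x∙y⁻¹≈ε⇒x≈y A x y (inj _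
      (LeftModule.≈ᴹ-trans B (HomProperties.-homo f x y) (GroupOf.x≈y⇒x∙y⁻¹≈ε B fx≈fy)))

  -- Preimages under an injective `i` are unique, so a choice made element by element is
  -- automatically linear. Maps are built this way from mere existence statements.
  factor-injective : {Y A X : Mod} (i : Hom A X) → IsInjective i → (f : Hom Y X) →
                     (∀ y → ∃[ a ] LeftModule._≈ᴹ_ X (⟦ i ⟧ a) (⟦ f ⟧ y)) →
                     Σ[ h ∈ Hom Y A ] (∀ y → LeftModule._≈ᴹ_ X (⟦ i ⟧ (⟦ h ⟧ y)) (⟦ f ⟧ y))
  factor-injective {Y} {A} {X} i inj f lift = mkHom h h-cong h-+ h-* , i∘h
    where
    module Y = LeftModule Y
    module A = LeftModule A
    module X = LeftModule X
    module I = HomProperties i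
    module F = HomProperties f
    open SetoidReasoning X.≈ᴹ-setoid
    h : Y.Carrierᴹ → A.Carrierᴹ
    h y = proj₁ (lift y)
    i∘h : ∀ y → ⟦ i ⟧ (h y) X.≈ᴹ ⟦ f ⟧ y
    i∘h y = proj₂ (lift y)
    h-cong : ∀ {x y} → x Y.≈ᴹ y → h x A.≈ᴹ h y
    h-cong {x} {y} x≈y = injective-cancel i inj (begin
      ⟦ i ⟧ (h x) ≈⟨ i∘h x ⟩
      ⟦ f ⟧ x     ≈⟨ F.⟦⟧-cong x≈y ⟩
      ⟦ f ⟧ y     ≈⟨ i∘h y ⟨
      ⟦ i ⟧ (h y) ∎)
    h-+ : ∀ x y → h (x Y.+ᴹ y) A.≈ᴹ (h x A.+ᴹ h y)
    h-+ x y = injective-cancel i inj (begin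
      ⟦ i ⟧ (h (x Y.+ᴹ y))           ≈⟨ i∘h _ ⟩
      ⟦ f ⟧ (x Y.+ᴹ y)               ≈⟨ F.+ᴹ-homo x y ⟩
      ⟦ f ⟧ x X.+ᴹ ⟦ f ⟧ y           ≈⟨ X.+ᴹ-cong (i∘h x) (i∘h y) ⟨
      ⟦ i ⟧ (h x) X.+ᴹ ⟦ i ⟧ (h y)   ≈⟨ I.+ᴹ-homo _ _ ⟨
      ⟦ i ⟧ (h x A.+ᴹ h y)           ∎)
    h-* : ∀ r x → h (r Y.*ₗ x) A.≈ᴹ (r A.*ₗ h x)
    h-* r x = injective-cancel i inj (begin
      ⟦ i ⟧ (h (r Y.*ₗ x))   ≈⟨ i∘h _ ⟩
      ⟦ f ⟧ (r Y.*ₗ x)       ≈⟨ F.*ₗ-homo r x ⟩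
      r X.*ₗ ⟦ f ⟧ x         ≈⟨ X.*ₗ-congˡ (i∘h x) ⟨
      r X.*ₗ ⟦ i ⟧ (h x)     ≈⟨ I.*ₗ-homo r _ ⟨
      ⟦ i ⟧ (r A.*ₗ h x)     ∎)

  -- Direct sums, kernels and cokernels.

  infixr 7 _⊕_
  _⊕_ : Mod → Mod → Mod
  _⊕_ = DirectProduct.leftModule

  π₁ : (A B : Mod) → Hom (A ⊕ B) A
  π₁ A B = mkHom proj₁ proj₁ (λ _ _ → A.≈ᴹ-refl) (λ _ _ → A.≈ᴹ-refl)
    where module A = LeftModule A

  π₂ : (A B : Mod) → Hom (A ⊕ B) B
  π₂ A B = mkHom proj₂ proj₂ (λ _ _ → B.≈ᴹ-refl) (λ _ _ → B.≈ᴹ-refl)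
    where module B = LeftModule B

  ⟨_,_⟩ : {X A B : Mod} → Hom X A → Hom X B → Hom X (A ⊕ B)
  ⟨ f , g ⟩ = mkHom (λ x → ⟦ f ⟧ x , ⟦ g ⟧ x)
    (λ x≈y → F.⟦⟧-cong x≈y , G.⟦⟧-cong x≈y)
    (λ x y → F.+ᴹ-homo x y , G.+ᴹ-homo x y)
    (λ r x → F.*ₗ-homo r x , G.*ₗ-homo r x)
    where
    module F = HomProperties f
    module G = HomProperties g

  ι₁ : (A B : Mod) → Hom A (A ⊕ B)
  ι₁ A B = ⟨ idHom A , zeroHom A B ⟩

  ι₂ : (A B : Mod) → Hom B (A ⊕ B)
  ι₂ A B = ⟨ zeroHom B A , idHom B ⟩

  infixr 7 _⊕ₕ_
  _⊕ₕ_ : {A B A′ B′ : Mod} → Hom A B → Hom A′ B′ → Hom (A ⊕ A′) (B ⊕ B′)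
  _⊕ₕ_ {A} {_} {A′} f g = ⟨ f ∘ₕ π₁ A A′ , g ∘ₕ π₂ A A′ ⟩

  Ker : {A B : Mod} → Hom A B → Mod
  Ker {A} {B} f = record
    { Carrierᴹ = Σ[ x ∈ A.Carrierᴹ ] ⟦ f ⟧ x B.≈ᴹ B.0ᴹ
    ; _≈ᴹ_ = λ x y → proj₁ x A.≈ᴹ proj₁ y
    ; _+ᴹ_ = λ { (x , fx) (y , fy) → x A.+ᴹ y ,
        B.≈ᴹ-trans (F.+ᴹ-homo x y) (B.≈ᴹ-trans (B.+ᴹ-cong fx fy) (B.+ᴹ-identityˡ _)) }
    ; _*ₗ_ = λ { r (x , fx) → r A.*ₗ x ,
        B.≈ᴹ-trans (F.*ₗ-homo r x) (B.≈ᴹ-trans (B.*ₗ-congˡ fx) (B.*ₗ-zeroʳ r)) }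
    ; 0ᴹ = A.0ᴹ , F.0ᴹ-homo
    ; -ᴹ_ = λ { (x , fx) → A.-ᴹ x ,
        B.≈ᴹ-trans (F.-ᴹ-homo x) (B.≈ᴹ-trans (B.-ᴹ‿cong fx) (GroupOf.ε⁻¹≈ε B)) }
    ; isLeftModule = record
      { isLeftSemimodule = record
        { +ᴹ-isCommutativeMonoid = record
          { isMonoid = record
            { isSemigroup = record
              { isMagma = record
                { isEquivalence = record
                  { refl = A.≈ᴹ-refl ; sym = A.≈ᴹ-sym ; trans = A.≈ᴹ-trans }
                ; ∙-cong = A.+ᴹ-cong
                }
              ; assoc = λ _ _ _ → A.+ᴹ-assoc _ _ _
              }
            ; identity = (λ _ → A.+ᴹ-identityˡ _) , (λ _ → A.+ᴹ-identityʳ _)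
            }
          ; comm = λ _ _ → A.+ᴹ-comm _ _
          }
        ; isPreleftSemimodule = record
          { *ₗ-cong = A.*ₗ-cong
          ; *ₗ-zeroˡ = λ _ → A.*ₗ-zeroˡ _
          ; *ₗ-distribʳ = λ _ _ _ → A.*ₗ-distribʳ _ _ _
          ; *ₗ-identityˡ = λ _ → A.*ₗ-identityˡ _
          ; *ₗ-assoc = λ _ _ _ → A.*ₗ-assoc _ _ _
          ; *ₗ-zeroʳ = A.*ₗ-zeroʳ
          ; *ₗ-distribˡ = λ _ _ _ → A.*ₗ-distribˡ _ _ _
          }
        }
      ; -ᴹ‿cong = A.-ᴹ‿cong
      ; -ᴹ‿inverse = (λ _ → A.-ᴹ‿inverseˡ _) , (λ _ → A.-ᴹ‿inverseʳ _)
      }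
    }
    where
    module A = LeftModule A
    module B = LeftModule B
    module F = HomProperties f

  kerInclusion : {A B : Mod} (f : Hom A B) → Hom (Ker f) A
  kerInclusion {A} f = mkHom proj₁ (λ x≈y → x≈y) (λ _ _ → A.≈ᴹ-refl) (λ _ _ → A.≈ᴹ-refl)
    where module A = LeftModule A

  -- The quotient keeps the carrier of `B` and coarsens its equality. Preimages, generators and
  -- annihilators in `B` therefore serve unchanged in the quotient.
  Coker : {A B : Mod} → Hom A B → Mod
  Coker {A} {B} f = record
    { Carrierᴹ = B.Carrierᴹ
    ; _≈ᴹ_ = _~_
    ; _+ᴹ_ = B._+ᴹ_
    ; _*ₗ_ = B._*ₗ_
    ; 0ᴹ = B.0ᴹ
    ; -ᴹ_ = B.-ᴹ_
    ; isLeftModule = record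
      { isLeftSemimodule = record
        { +ᴹ-isCommutativeMonoid = record
          { isMonoid = record
            { isSemigroup = record
              { isMagma = record
                { isEquivalence = record { refl = ≈⇒~ B.≈ᴹ-refl ; sym = ~-sym ; trans = ~-trans }
                ; ∙-cong = +-cong~
                }
              ; assoc = λ x y z → ≈⇒~ (B.+ᴹ-assoc x y z)
              }
            ; identity = (λ x → ≈⇒~ (B.+ᴹ-identityˡ x)) , (λ x → ≈⇒~ (B.+ᴹ-identityʳ x))
            }
          ; comm = λ x y → ≈⇒~ (B.+ᴹ-comm x y)
          }
        ; isPreleftSemimodule = record
          { *ₗ-cong = *-cong~
          ; *ₗ-zeroˡ = λ x → ≈⇒~ (B.*ₗ-zeroˡ x)
          ; *ₗ-distribʳ = λ x r s → ≈⇒~ (B.*ₗ-distribʳ x r s)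
          ; *ₗ-identityˡ = λ x → ≈⇒~ (B.*ₗ-identityˡ x)
          ; *ₗ-assoc = λ r s x → ≈⇒~ (B.*ₗ-assoc r s x)
          ; *ₗ-zeroʳ = λ r → ≈⇒~ (B.*ₗ-zeroʳ r)
          ; *ₗ-distribˡ = λ r x y → ≈⇒~ (B.*ₗ-distribˡ r x y)
          }
        }
      ; -ᴹ‿cong = neg-cong~
      ; -ᴹ‿inverse = (λ x → ≈⇒~ (B.-ᴹ‿inverseˡ x)) , (λ x → ≈⇒~ (B.-ᴹ‿inverseʳ x))
      }
    }
    where
    module A = LeftModule A
    module B = LeftModule B
    module F = HomProperties f
    module I = InterchangeOf B
    open SetoidReasoning B.≈ᴹ-setoid
    -- x ~ y is stated without subtraction, which makes the congruence laws direct.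
    _~_ : B.Carrierᴹ → B.Carrierᴹ → Set u
    x ~ y = ∃[ a ] x B.≈ᴹ (⟦ f ⟧ a B.+ᴹ y)
    ≈⇒~ : ∀ {x y} → x B.≈ᴹ y → x ~ y
    ≈⇒~ {x} {y} x≈y = A.0ᴹ , (begin
      x                     ≈⟨ x≈y ⟩
      y                     ≈⟨ B.+ᴹ-identityˡ y ⟨
      B.0ᴹ B.+ᴹ y           ≈⟨ B.+ᴹ-congʳ F.0ᴹ-homo ⟨
      ⟦ f ⟧ A.0ᴹ B.+ᴹ y     ∎)
    ~-sym : ∀ {x y} → x ~ y → y ~ x
    ~-sym {x} {y} (a , x≈fa+y) = A.-ᴹ a , (begin
      y                                       ≈⟨ GroupOf.\\-leftDividesʳ B (⟦ f ⟧ a) y ⟨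
      (B.-ᴹ ⟦ f ⟧ a) B.+ᴹ (⟦ f ⟧ a B.+ᴹ y)    ≈⟨ B.+ᴹ-cong (F.-ᴹ-homo a) x≈fa+y ⟨
      ⟦ f ⟧ (A.-ᴹ a) B.+ᴹ x                   ∎)
    ~-trans : ∀ {x y z} → x ~ y → y ~ z → x ~ z
    ~-trans {x} {y} {z} (a , x≈fa+y) (b , y≈fb+z) = a A.+ᴹ b , (begin
      x                                   ≈⟨ x≈fa+y ⟩
      ⟦ f ⟧ a B.+ᴹ y                      ≈⟨ B.+ᴹ-congˡ y≈fb+z ⟩
      ⟦ f ⟧ a B.+ᴹ (⟦ f ⟧ b B.+ᴹ z)       ≈⟨ B.+ᴹ-assoc _ _ _ ⟨
      (⟦ f ⟧ a B.+ᴹ ⟦ f ⟧ b) B.+ᴹ z       ≈⟨ B.+ᴹ-congʳ (F.+ᴹ-homo a b) ⟨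
      ⟦ f ⟧ (a A.+ᴹ b) B.+ᴹ z             ∎)
    +-cong~ : ∀ {x y z w} → x ~ y → z ~ w → (x B.+ᴹ z) ~ (y B.+ᴹ w)
    +-cong~ {x} {y} {z} {w} (a , x≈) (b , z≈) = a A.+ᴹ b , (begin
      x B.+ᴹ z                                     ≈⟨ B.+ᴹ-cong x≈ z≈ ⟩
      (⟦ f ⟧ a B.+ᴹ y) B.+ᴹ (⟦ f ⟧ b B.+ᴹ w)       ≈⟨ I.interchange _ _ _ _ ⟩
      (⟦ f ⟧ a B.+ᴹ ⟦ f ⟧ b) B.+ᴹ (y B.+ᴹ w)       ≈⟨ B.+ᴹ-congʳ (F.+ᴹ-homo a b) ⟨
      ⟦ f ⟧ (a A.+ᴹ b) B.+ᴹ (y B.+ᴹ w)             ∎)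
    *-cong~ : ∀ {r s x y} → r R.≈ s → x ~ y → (r B.*ₗ x) ~ (s B.*ₗ y)
    *-cong~ {r} {s} {x} {y} r≈s (a , x≈) = s A.*ₗ a , (begin
      r B.*ₗ x                            ≈⟨ B.*ₗ-cong r≈s x≈ ⟩
      s B.*ₗ (⟦ f ⟧ a B.+ᴹ y)             ≈⟨ B.*ₗ-distribˡ s _ _ ⟩
      (s B.*ₗ ⟦ f ⟧ a) B.+ᴹ (s B.*ₗ y)    ≈⟨ B.+ᴹ-congʳ (F.*ₗ-homo s a) ⟨
      ⟦ f ⟧ (s A.*ₗ a) B.+ᴹ (s B.*ₗ y)    ∎)
    neg-cong~ : ∀ {x y} → x ~ y → (B.-ᴹ x) ~ (B.-ᴹ y)
    neg-cong~ {x} {y} (a , x≈) = A.-ᴹ a , (begin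
      B.-ᴹ x                              ≈⟨ B.-ᴹ‿cong x≈ ⟩
      B.-ᴹ (⟦ f ⟧ a B.+ᴹ y)               ≈⟨ GroupOf.⁻¹-∙-comm B _ _ ⟨
      (B.-ᴹ ⟦ f ⟧ a) B.+ᴹ (B.-ᴹ y)        ≈⟨ B.+ᴹ-congʳ (F.-ᴹ-homo a) ⟨
      ⟦ f ⟧ (A.-ᴹ a) B.+ᴹ (B.-ᴹ y)        ∎)

  ≈⇒≈-Coker : {A B : Mod} (f : Hom A B) → ∀ {x y} →
              LeftModule._≈ᴹ_ B x y → LeftModule._≈ᴹ_ (Coker f) x y
  ≈⇒≈-Coker {A} {B} f {x} {y} x≈y = A.0ᴹ ,
    B.≈ᴹ-trans x≈y (B.≈ᴹ-trans (B.≈ᴹ-sym (B.+ᴹ-identityˡ y))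
      (B.+ᴹ-congʳ (B.≈ᴹ-sym (HomProperties.0ᴹ-homo f))))
    where
    module A = LeftModule A
    module B = LeftModule B

  cokerProjection : {A B : Mod} (f : Hom A B) → Hom B (Coker f)
  cokerProjection {A} {B} f =
    mkHom (λ x → x) (≈⇒≈-Coker f)
      (λ _ _ → LeftModule.≈ᴹ-refl (Coker f)) (λ _ _ → LeftModule.≈ᴹ-refl (Coker f))

  cokerLift : {A B C : Mod} (f : Hom A B) (g : Hom B C) →
              (∀ a → LeftModule._≈ᴹ_ C (⟦ g ⟧ (⟦ f ⟧ a)) (LeftModule.0ᴹ C)) →
              Hom (Coker f) C
  cokerLift {A} {B} {C} f g g∘f≈0 = mkHom ⟦ g ⟧ g-cong G.+ᴹ-homo G.*ₗ-homo
    where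
    module B = LeftModule B
    module C = LeftModule C
    module G = HomProperties g
    open SetoidReasoning C.≈ᴹ-setoid
    g-cong : ∀ {x y} → LeftModule._≈ᴹ_ (Coker f) x y → ⟦ g ⟧ x C.≈ᴹ ⟦ g ⟧ y
    g-cong {x} {y} (a , x≈fa+y) = begin
      ⟦ g ⟧ x                          ≈⟨ G.⟦⟧-cong x≈fa+y ⟩
      ⟦ g ⟧ (⟦ f ⟧ a B.+ᴹ y)           ≈⟨ G.+ᴹ-homo _ _ ⟩
      ⟦ g ⟧ (⟦ f ⟧ a) C.+ᴹ ⟦ g ⟧ y     ≈⟨ C.+ᴹ-congʳ (g∘f≈0 a) ⟩
      C.0ᴹ C.+ᴹ ⟦ g ⟧ y                ≈⟨ C.+ᴹ-identityˡ _ ⟩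
      ⟦ g ⟧ y                          ∎

  -- Short exact sequences and pullbacks.

  record SES (A B C : Mod) : Set u where
    private
      module B = LeftModule B
      module C = LeftModule C
    field
      inj           : Hom A B
      proj          : Hom B C
      inj-injective : IsInjective inj
      proj∘inj      : ∀ a → ⟦ proj ⟧ (⟦ inj ⟧ a) C.≈ᴹ C.0ᴹ
      kernel        : ∀ b → ⟦ proj ⟧ b C.≈ᴹ C.0ᴹ → ∃[ a ] ⟦ inj ⟧ a B.≈ᴹ b
      proj-onto     : IsOnto proj

  module _ {A B : Mod} (f : Hom A B) where
    private
      module B = LeftModule B

    onto⇒surjective : IsOnto f → IsSurjective f
    onto⇒surjective onto y with onto y
    ... | x , fx≈y = x , λ z≈x → B.≈ᴹ-trans (HomProperties.⟦⟧-cong f z≈x) fx≈y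

    surjective⇒onto : IsSurjective f → IsOnto f
    surjective⇒onto surj y with surj y
    ... | x , fx≈y = x , fx≈y (LeftModule.≈ᴹ-refl A)

    injective⇒exact : IsInjective f → ExactAt (fromZero A) f
    injective⇒exact f-inj y = mk⇔
      (λ fy≈0 → tt , LeftModule.≈ᴹ-sym A (f-inj y fy≈0))
      (λ { (_ , 0≈y) → HomProperties.0-cong f (LeftModule.≈ᴹ-sym A 0≈y) })

    exact⇒injective : ExactAt (fromZero A) f → IsInjective f
    exact⇒injective exact x fx≈0 =
      LeftModule.≈ᴹ-sym A (proj₂ (Equivalence.to (exact x) fx≈0))

  toExactSequence : {A C : Mod} (B : Vector Mod 1) → SES A (head B) C → ExactSequence A B C
  toExactSequence {C = C} B E =
    inj , injective⇒exact inj inj-injective ,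
    proj , (λ y → mk⇔ (kernel y)
      λ { (a , ia≈y) → C.≈ᴹ-trans (HomProperties.⟦⟧-cong proj (B.≈ᴹ-sym ia≈y)) (proj∘inj a) }) ,
    onto⇒surjective proj proj-onto
    where
    open SES E
    module B = LeftModule (head B)
    module C = LeftModule C

  fromExactSequence : {A C : Mod} (B : Vector Mod 1) → ExactSequence A B C → SES A (head B) C
  fromExactSequence B (i , i-exact , p , p-exact , p-surj) = record
    { inj = i
    ; proj = p
    ; inj-injective = exact⇒injective i i-exact
    ; proj∘inj = λ a → Equivalence.from (p-exact (⟦ i ⟧ a)) (a , LeftModule.≈ᴹ-refl (head B))
    ; kernel = λ b → Equivalence.to (p-exact b)
    ; proj-onto = surjective⇒onto p p-surj
    }

  isoSES : {A B : Mod} (f : Hom A B) → IsInjective f → IsOnto f → SES A B 0Mod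
  isoSES {A} {B} f f-inj f-onto = record
    { inj = f
    ; proj = zeroHom B 0Mod
    ; inj-injective = f-inj
    ; proj∘inj = λ _ → tt
    ; kernel = λ b _ → f-onto b
    ; proj-onto = λ _ → LeftModule.0ᴹ B , tt
    }

  identitySES : (A : Mod) → SES 0Mod A A
  identitySES A = record
    { inj = fromZero A
    ; proj = idHom A
    ; inj-injective = λ _ _ → tt
    ; proj∘inj = λ _ → A.≈ᴹ-refl
    ; kernel = λ b b≈0 → tt , A.≈ᴹ-sym b≈0
    ; proj-onto = λ a → a , A.≈ᴹ-refl
    }
    where module A = LeftModule A

  kernelSES : {A B : Mod} (f : Hom A B) → IsOnto f → SES (Ker f) A B
  kernelSES {A} f onto = record
    { inj = kerInclusion f
    ; proj = f
    ; inj-injective = λ _ x≈0 → x≈0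
    ; proj∘inj = proj₂
    ; kernel = λ b fb≈0 → (b , fb≈0) , LeftModule.≈ᴹ-refl A
    ; proj-onto = onto
    }

  cokernelSES : {A B : Mod} (f : Hom A B) → IsInjective f → SES A B (Coker f)
  cokernelSES {A} {B} f f-inj = record
    { inj = f
    ; proj = cokerProjection f
    ; inj-injective = f-inj
    ; proj∘inj = λ a → a , B.≈ᴹ-sym (B.+ᴹ-identityʳ _)
    ; kernel = λ { b (a , b≈fa+0) → a , B.≈ᴹ-sym (B.≈ᴹ-trans b≈fa+0 (B.+ᴹ-identityʳ _)) }
    ; proj-onto = λ b → b , LeftModule.≈ᴹ-refl (Coker f)
    }
    where module B = LeftModule B

  splitSES : (A B : Mod) → SES A (A ⊕ B) B
  splitSES A B = record
    { inj = ι₁ A B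
    ; proj = π₂ A B
    ; inj-injective = λ _ → proj₁
    ; proj∘inj = λ _ → B.≈ᴹ-refl
    ; kernel = λ { (a , b) b≈0 → a , A.≈ᴹ-refl , B.≈ᴹ-sym b≈0 }
    ; proj-onto = λ b → (A.0ᴹ , b) , B.≈ᴹ-refl
    }
    where
    module A = LeftModule A
    module B = LeftModule B

  ⊕-SES : {A B C A′ B′ C′ : Mod} → SES A B C → SES A′ B′ C′ → SES (A ⊕ A′) (B ⊕ B′) (C ⊕ C′)
  ⊕-SES {A} {B} {C} E E′ = record
    { inj = E.inj ⊕ₕ E′.inj
    ; proj = E.proj ⊕ₕ E′.proj
    ; inj-injective = λ { (a , a′) (ia≈0 , ia′≈0) → E.inj-injective a ia≈0 , E′.inj-injective a′ ia′≈0 }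
    ; proj∘inj = λ { (a , a′) → E.proj∘inj a , E′.proj∘inj a′ }
    ; kernel = λ { (b , b′) (pb≈0 , pb′≈0) →
        let (a , ia≈b) = E.kernel b pb≈0
            (a′ , ia′≈b′) = E′.kernel b′ pb′≈0
        in (a , a′) , ia≈b , ia′≈b′ }
    ; proj-onto = λ { (c , c′) →
        let (b , pb≈c) = E.proj-onto c
            (b′ , pb′≈c′) = E′.proj-onto c′
        in (b , b′) , pb≈c , pb′≈c′ }
    }
    where
    module E = SES E
    module E′ = SES E′

  -- Described by elements; `factor-injective` applied to the pair of projections recovers the
  -- universal map. The abstract record lets `swap` view one and the same `X` from both sides.
  record Pullback {A B M : Mod} (f : Hom A M) (g : Hom B M) : Set (lsuc u) where
    private
      module A = LeftModule A
      module B = LeftModule B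
      module M = LeftModule M
    field
      X         : Mod
      fst       : Hom X A
      snd       : Hom X B
      commutes  : ∀ x → ⟦ f ⟧ (⟦ fst ⟧ x) M.≈ᴹ ⟦ g ⟧ (⟦ snd ⟧ x)
      glue      : ∀ a b → ⟦ f ⟧ a M.≈ᴹ ⟦ g ⟧ b →
                  ∃[ x ] ⟦ fst ⟧ x A.≈ᴹ a × ⟦ snd ⟧ x B.≈ᴹ b
      separates : IsInjective ⟨ fst , snd ⟩

  swap : {A B M : Mod} {f : Hom A M} {g : Hom B M} → Pullback f g → Pullback g f
  swap {M = M} P = record
    { X = X
    ; fst = snd
    ; snd = fst
    ; commutes = λ x → LeftModule.≈ᴹ-sym M (commutes x)
    ; glue = λ b a gb≈fa →
        let (x , x₁ , x₂) = glue a b (LeftModule.≈ᴹ-sym M gb≈fa) in x , x₂ , x₁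
    ; separates = λ { x (x₂ , x₁) → separates x (x₁ , x₂) }
    }
    where open Pullback P

  equalizing : {A B M : Mod} → Hom A M → Hom B M → Hom (A ⊕ B) M
  equalizing {A} {B} f g = (f ∘ₕ π₁ A B) +ₕ (-ₕ (g ∘ₕ π₂ A B))

  pullback : {A B M : Mod} (f : Hom A M) (g : Hom B M) → Pullback f g
  pullback {A} {B} {M} f g = record
    { X = Ker (equalizing f g)
    ; fst = π₁ A B ∘ₕ kerInclusion (equalizing f g)
    ; snd = π₂ A B ∘ₕ kerInclusion (equalizing f g)
    ; commutes = λ { (_ , fa-gb≈0) → GroupOf.x∙y⁻¹≈ε⇒x≈y M _ _ fa-gb≈0 }
    ; glue = λ a b fa≈gb → ((a , b) , GroupOf.x≈y⇒x∙y⁻¹≈ε M fa≈gb) ,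
        LeftModule.≈ᴹ-refl A , LeftModule.≈ᴹ-refl B
    ; separates = λ _ x≈0 → x≈0
    }

  -- An element of `X` killed by `snd` is determined by its first coordinate, which lies in the
  -- kernel of A → M. Base change therefore leaves the kernel `N` unchanged.
  pullback-kernel : {N A M B : Mod} (E : SES N A M) (g : Hom B M)
                    (X : Pullback (SES.proj E) g) → SES N (Pullback.X X) B
  pullback-kernel {N} {A} {M} {B} E g P = record
    { inj = j
    ; proj = snd
    ; inj-injective = λ n jn≈0 → inj-injective n
        (A.≈ᴹ-trans (A.≈ᴹ-sym (proj₁ (j-fac n))) (HomProperties.0-cong fst jn≈0))
    ; proj∘inj = λ n → proj₂ (j-fac n)
    ; kernel = λ x snd-x≈0 →
        let (n , in≈fst-x) = kernel (⟦ fst ⟧ x)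
              (M.≈ᴹ-trans (commutes x) (HomProperties.0-cong g snd-x≈0))
        in n , injective-cancel ⟨ fst , snd ⟩ separates
                 ( A.≈ᴹ-trans (proj₁ (j-fac n)) in≈fst-x
                 , B.≈ᴹ-trans (proj₂ (j-fac n)) (B.≈ᴹ-sym snd-x≈0))
    ; proj-onto = λ b →
        let (a , pa≈gb) = proj-onto (⟦ g ⟧ b)
            (x , _ , snd-x≈b) = glue a b pa≈gb
        in x , snd-x≈b
    }
    where
    open SES E
    open Pullback P
    module A = LeftModule A
    module B = LeftModule B
    module M = LeftModule M
    factored : Σ[ h ∈ Hom N X ] (∀ n → LeftModule._≈ᴹ_ (A ⊕ B) _ _)
    factored = factor-injective ⟨ fst , snd ⟩ separates ⟨ inj , zeroHom N B ⟩
      (λ n → glue (⟦ inj ⟧ n) B.0ᴹ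
        (M.≈ᴹ-trans (proj∘inj n) (M.≈ᴹ-sym (HomProperties.0ᴹ-homo g))))
    j : Hom N X
    j = proj₁ factored
    j-fac : ∀ n → ⟦ fst ⟧ (⟦ j ⟧ n) A.≈ᴹ ⟦ inj ⟧ n × ⟦ snd ⟧ (⟦ j ⟧ n) B.≈ᴹ B.0ᴹ
    j-fac = proj₂ factored

  -- An element of `A` comes from `X` exactly when its image in `M` lies in `M′`, that is, when it
  -- dies in `P`.
  pullback-cokernel : {M′ M P A : Mod} (E : SES M′ M P) (f : Hom A M) → IsOnto f →
                      (X : Pullback f (SES.inj E)) → SES (Pullback.X X) A P
  pullback-cokernel {M′} {M} {P} {A} E f f-onto Q = record
    { inj = fst
    ; proj = proj ∘ₕ f
    ; inj-injective = λ x fst-x≈0 → separates x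
        (fst-x≈0 , inj-injective _
          (M.≈ᴹ-trans (M.≈ᴹ-sym (commutes x)) (HomProperties.0-cong f fst-x≈0)))
    ; proj∘inj = λ x → P.≈ᴹ-trans (HomProperties.⟦⟧-cong proj (commutes x)) (proj∘inj _)
    ; kernel = λ a pfa≈0 →
        let (m′ , im′≈fa) = kernel (⟦ f ⟧ a) pfa≈0
            (x , fst-x≈a , _) = glue a m′ (M.≈ᴹ-sym im′≈fa)
        in x , fst-x≈a
    ; proj-onto = λ p →
        let (m , pm≈p) = proj-onto p
            (a , fa≈m) = f-onto m
        in a , P.≈ᴹ-trans (HomProperties.⟦⟧-cong proj fa≈m) pm≈p
    }
    where
    open SES E
    open Pullback Q
    module M = LeftModule M
    module P = LeftModule P

  -- Splittings, projectivity and projective dimension at most one.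

  module _ {A X C : Mod} (E : SES A X C) (C-projective : Projective C) where
    open SES E
    private
      module A = LeftModule A
      module X = LeftModule X
      module C = LeftModule C

    section : Hom C X
    section = proj₁ (C-projective proj (onto⇒surjective proj proj-onto) (idHom C))

    proj∘section : ∀ c → ⟦ proj ⟧ (⟦ section ⟧ c) C.≈ᴹ c
    proj∘section = proj₂ (C-projective proj (onto⇒surjective proj proj-onto) (idHom C))

    private
      -- Subtracting `section (proj x)` from `x` lands in the kernel of `proj`; read in `A`, this
      -- difference is the retraction.
      residue : Hom X X
      residue = idHom X +ₕ (-ₕ (section ∘ₕ proj))

      residue-lift : ∀ x → ∃[ a ] ⟦ inj ⟧ a X.≈ᴹ ⟦ residue ⟧ x
      residue-lift x = kernel _ (C.≈ᴹ-trans (HomProperties.-homo proj x _)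
        (GroupOf.x≈y⇒x∙y⁻¹≈ε C (C.≈ᴹ-sym (proj∘section _))))

      factored : Σ[ r ∈ Hom X A ] (∀ x → ⟦ inj ⟧ (⟦ r ⟧ x) X.≈ᴹ ⟦ residue ⟧ x)
      factored = factor-injective inj inj-injective residue residue-lift

    retraction : Hom X A
    retraction = proj₁ factored

    decomposition : ∀ x → (⟦ inj ⟧ (⟦ retraction ⟧ x) X.+ᴹ ⟦ section ⟧ (⟦ proj ⟧ x)) X.≈ᴹ x
    decomposition x = X.≈ᴹ-trans (X.+ᴹ-congʳ (proj₂ factored x))
      (GroupOf.//-rightDividesˡ X _ x)

    retraction∘inj : ∀ a → ⟦ retraction ⟧ (⟦ inj ⟧ a) A.≈ᴹ a
    retraction∘inj a = injective-cancel inj inj-injective (begin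
      ⟦ inj ⟧ (⟦ retraction ⟧ ia)                              ≈⟨ X.+ᴹ-identityʳ _ ⟨
      ⟦ inj ⟧ (⟦ retraction ⟧ ia) X.+ᴹ X.0ᴹ
        ≈⟨ X.+ᴹ-congˡ (HomProperties.0-cong section (proj∘inj a)) ⟨
      ⟦ inj ⟧ (⟦ retraction ⟧ ia) X.+ᴹ ⟦ section ⟧ (⟦ proj ⟧ ia) ≈⟨ decomposition ia ⟩
      ia                                                       ∎)
      where
      open SetoidReasoning X.≈ᴹ-setoid
      ia : X.Carrierᴹ
      ia = ⟦ inj ⟧ a

    -- `A` is a retract of `X`: extend `f` along the retraction, lift, and restrict to `A`.
    projective-sub : Projective X → Projective A
    projective-sub X-projective {B = Z} g g-surj f =
      let (h , g∘h) = X-projective g g-surj (f ∘ₕ retraction) in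
      h ∘ₕ inj , λ a → LeftModule.≈ᴹ-trans Z (g∘h _) (HomProperties.⟦⟧-cong f (retraction∘inj a))

    -- Lift on `A` and on `C` separately and add the lifts; `decomposition` reassembles `f`.
    projective-extension : Projective A → Projective X
    projective-extension A-projective {Y} {Z} g g-surj f =
      (hᴬ ∘ₕ retraction) +ₕ (hᶜ ∘ₕ proj) , λ x → begin
        ⟦ g ⟧ (⟦ hᴬ ∘ₕ retraction ⟧ x Y.+ᴹ ⟦ hᶜ ∘ₕ proj ⟧ x)            ≈⟨ G.+ᴹ-homo _ _ ⟩
        ⟦ g ⟧ (⟦ hᴬ ∘ₕ retraction ⟧ x) Z.+ᴹ ⟦ g ⟧ (⟦ hᶜ ∘ₕ proj ⟧ x)
          ≈⟨ Z.+ᴹ-cong (proj₂ (A-projective g g-surj (f ∘ₕ inj)) _)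
                       (proj₂ (C-projective g g-surj (f ∘ₕ section)) _) ⟩
        ⟦ f ⟧ (⟦ inj ⟧ (⟦ retraction ⟧ x)) Z.+ᴹ ⟦ f ⟧ (⟦ section ⟧ (⟦ proj ⟧ x))
          ≈⟨ F.+ᴹ-homo _ _ ⟨
        ⟦ f ⟧ (⟦ inj ⟧ (⟦ retraction ⟧ x) X.+ᴹ ⟦ section ⟧ (⟦ proj ⟧ x)) ≈⟨ F.⟦⟧-cong (decomposition x) ⟩
        ⟦ f ⟧ x                                                         ∎
      where
      module Y = LeftModule Y
      module Z = LeftModule Z
      module G = HomProperties g
      module F = HomProperties f
      open SetoidReasoning Z.≈ᴹ-setoid
      hᴬ : Hom A Y
      hᴬ = proj₁ (A-projective g g-surj (f ∘ₕ inj))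
      hᶜ : Hom C Y
      hᶜ = proj₁ (C-projective g g-surj (f ∘ₕ section))

  ᵣR : Mod
  ᵣR = TensorUnit.leftModule {R = R}

  multiplesOf : (M : Mod) → Carrierᴹ M → Hom ᵣR M
  multiplesOf M m = mkHom (M._*ₗ m) M.*ₗ-congʳ (M.*ₗ-distribʳ m) (λ r x → M.*ₗ-assoc r x m)
    where module M = LeftModule M

  projective-0 : Projective (0Mod {R = R})
  projective-0 {A} {B} g g-surj f = fromZero A , λ _ →
    LeftModule.≈ᴹ-trans B (HomProperties.0ᴹ-homo g)
      (LeftModule.≈ᴹ-sym B (HomProperties.0ᴹ-homo f))

  projective-R : Projective ᵣR
  projective-R {A} {B} g g-surj f = multiplesOf A a , λ x → begin
    ⟦ g ⟧ (x A.*ₗ a)          ≈⟨ HomProperties.*ₗ-homo g x a ⟩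
    x B.*ₗ ⟦ g ⟧ a            ≈⟨ B.*ₗ-congˡ (proj₂ (surjective⇒onto g g-surj (⟦ f ⟧ R.1#))) ⟩
    x B.*ₗ ⟦ f ⟧ R.1#         ≈⟨ HomProperties.*ₗ-homo f x R.1# ⟨
    ⟦ f ⟧ (x R.* R.1#)        ≈⟨ HomProperties.⟦⟧-cong f (R.*-identityʳ x) ⟩
    ⟦ f ⟧ x                   ∎
    where
    module A = LeftModule A
    module B = LeftModule B
    open SetoidReasoning B.≈ᴹ-setoid
    a : A.Carrierᴹ
    a = proj₁ (surjective⇒onto g g-surj (⟦ f ⟧ R.1#))

  projective-⊕ : {A B : Mod} → Projective A → Projective B → Projective (A ⊕ B)
  projective-⊕ {A} {B} A-projective B-projective =
    projective-extension (splitSES A B) B-projective A-projective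

  pd≤1 : {Q Q₁ M : Mod} → Projective Q → Projective Q₁ → SES Q Q₁ M → ProjDim≤ 1 M
  pd≤1 {Q} {Q₁} Q-projective Q₁-projective E =
    Q , (Q₁ ∷ []) , Q-projective , (λ { zero → Q₁-projective }) , toExactSequence (Q₁ ∷ []) E

  pd≤1-⊕ : {A B : Mod} → ProjDim≤ 1 A → ProjDim≤ 1 B → ProjDim≤ 1 (A ⊕ B)
  pd≤1-⊕ (_ , Qs , Q-proj , Qs-proj , E) (_ , Qs′ , Q′-proj , Qs′-proj , E′) =
    pd≤1 (projective-⊕ Q-proj Q′-proj) (projective-⊕ (Qs-proj zero) (Qs′-proj zero))
      (⊕-SES (fromExactSequence Qs E) (fromExactSequence Qs′ E′))

  -- Schanuel's argument: the pullback of two projective covers of P is an extension of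
  -- projectives in one direction and a split extension of the other cover by H in the other.
  projective-syzygy : {H G P : Mod} → SES H G P → Projective G → ProjDim≤ 1 P → Projective H
  projective-syzygy {P = P} E G-proj (Q , Qs , Q-proj , Qs-proj , E′) =
    projective-sub
      (pullback-kernel E (SES.proj E″) X) (Qs-proj zero)
      (projective-extension (pullback-kernel E″ (SES.proj E) (swap X)) G-proj Q-proj)
    where
    E″ : SES Q (head Qs) P
    E″ = fromExactSequence Qs E′
    X : Pullback (SES.proj E) (SES.proj E″)
    X = pullback (SES.proj E) (SES.proj E″)

  -- For a resolution 0 → G₁ → G → Q → 0, the preimage X of K in G sits in 0 → G₁ → X → K → 0. It is
  -- also the kernel of G → P, a first syzygy of P, so it is projective.
  pd≤1-kernel : {K Q P : Mod} → SES K Q P → ProjDim≤ 1 Q → ProjDim≤ 1 P → ProjDim≤ 1 K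
  pd≤1-kernel {Q = Q} E (G₁ , Gs , G₁-proj , Gs-proj , E′) P-pd =
    pd≤1 G₁-proj
      (projective-syzygy (pullback-cokernel E (SES.proj E″) (SES.proj-onto E″) X) (Gs-proj zero) P-pd)
      (pullback-kernel E″ (SES.inj E) X)
    where
    E″ : SES G₁ (head Gs) Q
    E″ = fromExactSequence Gs E′
    X : Pullback (SES.proj E″) (SES.inj E)
    X = pullback (SES.proj E″) (SES.inj E)

  -- Splicing and cutting long exact sequences.

  exactFrom-resp-image :
    ∀ {n} {A A′ B M : Mod} {P : Vector Mod n} (f : Hom A B) (f′ : Hom A′ B) →
    (∀ {C : Mod} (g : Hom B C) → ExactAt f g → ExactAt f′ g) →
    ExactFrom f P M → ExactFrom f′ P M
  -- `f` occurs only in the first exactness condition, so the rest of the sequence is kept.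
  exactFrom-resp-image {zero}  f f′ transfer (g , exact , surj) = g , transfer g exact , surj
  exactFrom-resp-image {suc n} f f′ transfer (g , exact , rest) = g , transfer g exact , rest

  exactAt-∘-onto : {A A′ B C : Mod} (f : Hom A B) (p : Hom A′ A) → IsOnto p →
                   (g : Hom B C) → ExactAt f g → ExactAt (f ∘ₕ p) g
  exactAt-∘-onto {B = B} f p p-onto g exact y = mk⇔
    (λ gy≈0 →
      let (x , fx≈y) = Equivalence.to (exact y) gy≈0
          (x′ , px′≈x) = p-onto x
      in x′ , LeftModule.≈ᴹ-trans B (HomProperties.⟦⟧-cong f px′≈x) fx≈y)
    (λ { (x′ , fpx′≈y) → Equivalence.from (exact y) (⟦ p ⟧ x′ , fpx′≈y) })

  module _ {A B C : Mod} (E : SES A B C) where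
    open SES E

    exactAt-∘proj : {D : Mod} (g : Hom C D) → IsInjective g → ExactAt inj (g ∘ₕ proj)
    exactAt-∘proj g g-inj y = mk⇔
      (λ gpy≈0 → kernel y (g-inj _ gpy≈0))
      (λ { (a , ia≈y) → HomProperties.0-cong g (LeftModule.≈ᴹ-trans C
        (HomProperties.⟦⟧-cong proj (LeftModule.≈ᴹ-sym B ia≈y)) (proj∘inj a)) })

    -- The new map is the composite of B → C with the first map out of C. Injectivity of the latter
    -- makes its kernel the image of A; surjectivity of B → C preserves its image, so exactness
    -- further on survives.
    splice : ∀ {n} {M : Mod} (P : Vector Mod n) → ExactSequence C P M → ExactSequence A (B ∷ P) M
    splice {n} {M} P E′ = inj , injective⇒exact inj inj-injective , continue n P E′
      where
      continue : ∀ n (P : Vector Mod n) → ExactSequence C P M → ExactFrom inj P M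
      continue zero P (g , g-exact , g-surj) =
        g ∘ₕ proj , exactAt-∘proj g (exact⇒injective g g-exact) ,
        onto⇒surjective (g ∘ₕ proj) (λ z →
          let (y , gy≈z) = surjective⇒onto g g-surj z
              (x , px≈y) = proj-onto y
          in x , LeftModule.≈ᴹ-trans M (HomProperties.⟦⟧-cong g px≈y) gy≈z)
      continue (suc n) P (g , g-exact , rest) =
        g ∘ₕ proj , exactAt-∘proj g (exact⇒injective g g-exact) ,
        exactFrom-resp-image g (g ∘ₕ proj) (exactAt-∘-onto g proj proj-onto) rest

  module _ {A B : Mod} (f : Hom A B) where
    private
      module B = LeftModule B

    module _ {C : Mod} (g : Hom B C) (exact : ExactAt f g) where

      descendHom : Hom (Coker f) C
      descendHom = cokerLift f g (λ a → Equivalence.from (exact (⟦ f ⟧ a)) (a , B.≈ᴹ-refl))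

      descendHom-injective : IsInjective descendHom
      descendHom-injective x gx≈0 =
        let (a , fa≈x) = Equivalence.to (exact x) gx≈0
        in a , B.≈ᴹ-trans (B.≈ᴹ-sym fa≈x) (B.≈ᴹ-sym (B.+ᴹ-identityʳ _))

    -- Exactness at `B` says that the next map kills the image of `f` and nothing more, so it
    -- induces an injection on the cokernel.
    descend : ∀ n {M : Mod} (P : Vector Mod n) → ExactFrom f P M → ExactSequence (Coker f) P M
    descend zero P (g , exact , g-surj) =
      descendHom g exact ,
      injective⇒exact (descendHom g exact) (descendHom-injective g exact) ,
      onto⇒surjective (descendHom g exact) (surjective⇒onto g g-surj)
    descend (suc n) P (g , exact , rest) =
      descendHom g exact ,
      injective⇒exact (descendHom g exact) (descendHom-injective g exact) ,
      -- `descendHom` has the same underlying function as `g`, hence literally the same image.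
      exactFrom-resp-image g (descendHom g exact) (λ _ e → e) rest

  -- Finite generation over a noetherian ring.

  module _ (M : Mod) where
    private
      module M = LeftModule M
      module I = InterchangeOf M
    open SetoidReasoning M.≈ᴹ-setoid

    linComb-cong : ∀ {k} {c d : Vector R.Carrier k} {g h : Vector M.Carrierᴹ k} →
                   (∀ i → c i R.≈ d i) → (∀ i → g i M.≈ᴹ h i) →
                   linComb M c g M.≈ᴹ linComb M d h
    linComb-cong {zero}  c≈d g≈h = M.≈ᴹ-refl
    linComb-cong {suc k} c≈d g≈h =
      M.+ᴹ-cong (M.*ₗ-cong (c≈d zero) (g≈h zero)) (linComb-cong (c≈d ∘ suc) (g≈h ∘ suc))

    linComb-zero : ∀ {k} (g : Vector M.Carrierᴹ k) → linComb M (λ _ → R.0#) g M.≈ᴹ M.0ᴹ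
    linComb-zero {zero}  g = M.≈ᴹ-refl
    linComb-zero {suc k} g =
      M.≈ᴹ-trans (M.+ᴹ-cong (M.*ₗ-zeroˡ _) (linComb-zero (tail g))) (M.+ᴹ-identityˡ _)

    linComb-+ : ∀ {k} (c d : Vector R.Carrier k) (g : Vector M.Carrierᴹ k) →
                linComb M (λ i → c i R.+ d i) g M.≈ᴹ (linComb M c g M.+ᴹ linComb M d g)
    linComb-+ {zero}  c d g = M.≈ᴹ-sym (M.+ᴹ-identityˡ _)
    linComb-+ {suc k} c d g =
      M.≈ᴹ-trans (M.+ᴹ-cong (M.*ₗ-distribʳ _ _ _) (linComb-+ (tail c) (tail d) (tail g)))
                 (I.interchange _ _ _ _)

    linComb-* : ∀ {k} r (c : Vector R.Carrier k) (g : Vector M.Carrierᴹ k) →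
                linComb M (λ i → r R.* c i) g M.≈ᴹ (r M.*ₗ linComb M c g)
    linComb-* {zero}  r c g = M.≈ᴹ-sym (M.*ₗ-zeroʳ r)
    linComb-* {suc k} r c g =
      M.≈ᴹ-trans (M.+ᴹ-cong (M.*ₗ-assoc _ _ _) (linComb-* r (tail c) (tail g)))
                 (M.≈ᴹ-sym (M.*ₗ-distribˡ r _ _))

    linComb-++ : ∀ {k l} (c : Vector R.Carrier k) (d : Vector R.Carrier l)
                 (g : Vector M.Carrierᴹ k) (h : Vector M.Carrierᴹ l) →
                 linComb M (c ++ d) (g ++ h) M.≈ᴹ (linComb M c g M.+ᴹ linComb M d h)
    linComb-++ {zero}  c d g h = M.≈ᴹ-sym (M.+ᴹ-identityˡ _)
    linComb-++ {suc k} c d g h = begin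
      (head c M.*ₗ head g) M.+ᴹ linComb M (tail (c ++ d)) (tail (g ++ h))
        ≈⟨ M.+ᴹ-congˡ (linComb-cong (λ i → R.reflexive (tail-++ c d i))
                                    (λ i → M.≈ᴹ-reflexive (tail-++ g h i))) ⟩
      (head c M.*ₗ head g) M.+ᴹ linComb M (tail c ++ d) (tail g ++ h)
        ≈⟨ M.+ᴹ-congˡ (linComb-++ (tail c) d (tail g) h) ⟩
      (head c M.*ₗ head g) M.+ᴹ (linComb M (tail c) (tail g) M.+ᴹ linComb M d h)
        ≈⟨ M.+ᴹ-assoc _ _ _ ⟨
      linComb M c g M.+ᴹ linComb M d h ∎

    Span : ∀ {k} → Vector M.Carrierᴹ k → Pred M.Carrierᴹ u
    Span g x = ∃[ c ] x M.≈ᴹ linComb M c g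

    span-isSubmodule : ∀ {k} (g : Vector M.Carrierᴹ k) → IsSubmodule M (Span g)
    span-isSubmodule g = record
      { ∈-resp-≈ = λ { x≈y (c , x≈) → c , M.≈ᴹ-trans (M.≈ᴹ-sym x≈y) x≈ }
      ; 0∈       = (λ _ → R.0#) , M.≈ᴹ-sym (linComb-zero g)
      ; +-closed = λ { (c , x≈) (d , y≈) → (λ i → c i R.+ d i) ,
          M.≈ᴹ-trans (M.+ᴹ-cong x≈ y≈) (M.≈ᴹ-sym (linComb-+ c d g)) }
      ; *-closed = λ { r (c , x≈) → (λ i → r R.* c i) ,
          M.≈ᴹ-trans (M.*ₗ-congˡ x≈) (M.≈ᴹ-sym (linComb-* r c g)) }
      }

    ∩-isSubmodule : {N K : Pred M.Carrierᴹ u} →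
                    IsSubmodule M N → IsSubmodule M K → IsSubmodule M (N ∩ K)
    ∩-isSubmodule N K = record
      { ∈-resp-≈ = λ { x≈y (x∈N , x∈K) → N.∈-resp-≈ x≈y x∈N , K.∈-resp-≈ x≈y x∈K }
      ; 0∈       = N.0∈ , K.0∈
      ; +-closed = λ { (x∈N , x∈K) (y∈N , y∈K) → N.+-closed x∈N y∈N , K.+-closed x∈K y∈K }
      ; *-closed = λ { r (x∈N , x∈K) → N.*-closed r x∈N , K.*-closed r x∈K }
      }
      where
      module N = IsSubmodule N
      module K = IsSubmodule K

    module _ {N : Pred M.Carrierᴹ u} (N-isSubmodule : IsSubmodule M N) where
      open IsSubmodule N-isSubmodule

      linComb-∈ : ∀ {k} (c : Vector R.Carrier k) {g : Vector M.Carrierᴹ k} →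
                  (∀ i → g i ∈ N) → linComb M c g ∈ N
      linComb-∈ {zero}  c g∈N = 0∈
      linComb-∈ {suc k} c g∈N =
        +-closed (*-closed (head c) (g∈N zero)) (linComb-∈ (tail c) (g∈N ∘ suc))

      neg-closed : ∀ {x} → x ∈ N → (M.-ᴹ x) ∈ N
      neg-closed {x} x∈N = ∈-resp-≈ (GroupOf.inverseˡ-unique M _ x (begin
        ((R.- R.1#) M.*ₗ x) M.+ᴹ x                ≈⟨ M.+ᴹ-congˡ (M.*ₗ-identityˡ x) ⟨
        ((R.- R.1#) M.*ₗ x) M.+ᴹ (R.1# M.*ₗ x)    ≈⟨ M.*ₗ-distribʳ x _ _ ⟨
        (R.- R.1# R.+ R.1#) M.*ₗ x                ≈⟨ M.*ₗ-congʳ (R.-‿inverseˡ R.1#) ⟩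
        R.0# M.*ₗ x                               ≈⟨ M.*ₗ-zeroˡ x ⟩
        M.0ᴹ                                      ∎))
        (*-closed (R.- R.1#) x∈N)

    module _ {k} (y : M.Carrierᴹ) (g : Vector M.Carrierᴹ k) where

      -- This is x ≡ a y modulo the span of `g`. It is a relation and not a function because `x`
      -- need not determine its coefficient `a`.
      Congruent : R.Carrier → M.Carrierᴹ → Set u
      Congruent a x = ∃[ z ] z ∈ Span g × x M.≈ᴹ ((a M.*ₗ y) M.+ᴹ z)

      private
        module Spanᵍ = IsSubmodule (span-isSubmodule g)

      congruent-0 : Congruent R.0# M.0ᴹ
      congruent-0 = M.0ᴹ , Spanᵍ.0∈ ,
        M.≈ᴹ-sym (M.≈ᴹ-trans (M.+ᴹ-identityʳ _) (M.*ₗ-zeroˡ y))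

      congruent-+ : ∀ {a b x x′} → Congruent a x → Congruent b x′ → Congruent (a R.+ b) (x M.+ᴹ x′)
      congruent-+ {a} {b} {x} {x′} (z , z∈ , x≈) (z′ , z′∈ , x′≈) =
        z M.+ᴹ z′ , Spanᵍ.+-closed z∈ z′∈ , (begin
          x M.+ᴹ x′                                            ≈⟨ M.+ᴹ-cong x≈ x′≈ ⟩
          ((a M.*ₗ y) M.+ᴹ z) M.+ᴹ ((b M.*ₗ y) M.+ᴹ z′)        ≈⟨ I.interchange _ _ _ _ ⟩
          ((a M.*ₗ y) M.+ᴹ (b M.*ₗ y)) M.+ᴹ (z M.+ᴹ z′)        ≈⟨ M.+ᴹ-congʳ (M.*ₗ-distribʳ y a b) ⟨
          ((a R.+ b) M.*ₗ y) M.+ᴹ (z M.+ᴹ z′)                  ∎)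

      congruent-* : ∀ {a x} r → Congruent a x → Congruent (r R.* a) (r M.*ₗ x)
      congruent-* {a} {x} r (z , z∈ , x≈) = r M.*ₗ z , Spanᵍ.*-closed r z∈ , (begin
        r M.*ₗ x                                    ≈⟨ M.*ₗ-congˡ x≈ ⟩
        r M.*ₗ ((a M.*ₗ y) M.+ᴹ z)                  ≈⟨ M.*ₗ-distribˡ r _ _ ⟩
        (r M.*ₗ (a M.*ₗ y)) M.+ᴹ (r M.*ₗ z)         ≈⟨ M.+ᴹ-congʳ (M.*ₗ-assoc r a y) ⟨
        ((r R.* a) M.*ₗ y) M.+ᴹ (r M.*ₗ z)          ∎)

      congruent-resp : ∀ {a b x} → a R.≈ b → Congruent a x → Congruent b x
      congruent-resp a≈b (z , z∈ , x≈) =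
        z , z∈ , M.≈ᴹ-trans x≈ (M.+ᴹ-congʳ (M.*ₗ-congʳ a≈b))

      congruent-linComb : ∀ {m} (c : Vector R.Carrier m) {a : Vector R.Carrier m}
                          {x : Vector M.Carrierᴹ m} → (∀ i → Congruent (a i) (x i)) →
                          Congruent (linComb ᵣR c a) (linComb M c x)
      congruent-linComb {zero}  c a~x = congruent-0
      congruent-linComb {suc m} c a~x =
        congruent-+ (congruent-* (head c) (a~x zero)) (congruent-linComb (tail c) (a~x ∘ suc))

      congruent-difference : ∀ {a x x′} → Congruent a x → Congruent a x′ →
                             (x M.+ᴹ (M.-ᴹ x′)) ∈ Span g
      congruent-difference {a} {x} {x′} (z , z∈ , x≈) (z′ , z′∈ , x′≈) =
        Spanᵍ.∈-resp-≈ (M.≈ᴹ-sym (begin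
          x M.+ᴹ (M.-ᴹ x′)
            ≈⟨ M.+ᴹ-cong x≈ (M.≈ᴹ-trans (M.-ᴹ‿cong x′≈) (M.≈ᴹ-sym (GroupOf.⁻¹-∙-comm M _ _))) ⟩
          ((a M.*ₗ y) M.+ᴹ z) M.+ᴹ ((M.-ᴹ (a M.*ₗ y)) M.+ᴹ (M.-ᴹ z′)) ≈⟨ I.interchange _ _ _ _ ⟩
          ((a M.*ₗ y) M.+ᴹ (M.-ᴹ (a M.*ₗ y))) M.+ᴹ (z M.+ᴹ (M.-ᴹ z′))
            ≈⟨ M.+ᴹ-congʳ (M.-ᴹ‿inverseʳ _) ⟩
          M.0ᴹ M.+ᴹ (z M.+ᴹ (M.-ᴹ z′))    ≈⟨ M.+ᴹ-identityˡ _ ⟩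
          z M.+ᴹ (M.-ᴹ z′)               ∎))
          (Spanᵍ.+-closed z∈ (neg-closed (span-isSubmodule g) z′∈))

    -- The coefficients of g zero occurring in N form a left ideal; lifting generators of it
    -- to N reduces N to its intersection with the span of the remaining generators.
    submodule-finitelyGenerated :
      LeftNoetherian R → ∀ k (g : Vector M.Carrierᴹ k) (N : Pred M.Carrierᴹ u) →
      IsSubmodule M N → N ⊆ Span g → FinitelyGeneratedSub M N
    submodule-finitelyGenerated noetherian zero g N N-sub N⊆ =
      0 , [] , (λ ()) , λ x x∈N → [] , proj₂ (N⊆ x∈N)
    submodule-finitelyGenerated noetherian (suc k) g N N-sub N⊆ =
      m + l , xs ++ ys , gens∈N , generate
      where
      module N = IsSubmodule N-sub
      I : Pred R.Carrier u
      I a = ∃[ x ] x ∈ N × Congruent (head g) (tail g) a x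
      I-sub : IsSubmodule ᵣR I
      I-sub = record
        { ∈-resp-≈ = λ { a≈b (x , x∈N , a~x) → x , x∈N , congruent-resp _ _ a≈b a~x }
        ; 0∈       = M.0ᴹ , N.0∈ , congruent-0 _ _
        ; +-closed = λ { (x , x∈N , a~x) (y , y∈N , b~y) →
            x M.+ᴹ y , N.+-closed x∈N y∈N , congruent-+ _ _ a~x b~y }
        ; *-closed = λ { r (x , x∈N , a~x) → r M.*ₗ x , N.*-closed r x∈N , congruent-* _ _ r a~x }
        }
      I-fg : FinitelyGeneratedSub ᵣR I
      I-fg = noetherian I I-sub
      m : ℕ
      m = proj₁ I-fg
      as : Vector R.Carrier m
      as = proj₁ (proj₂ I-fg)
      as∈I : ∀ i → as i ∈ I
      as∈I = proj₁ (proj₂ (proj₂ I-fg))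
      xs : Vector M.Carrierᴹ m
      xs i = proj₁ (as∈I i)
      xs∈N : ∀ i → xs i ∈ N
      xs∈N i = proj₁ (proj₂ (as∈I i))
      N′-fg : FinitelyGeneratedSub M (N ∩ Span (tail g))
      N′-fg = submodule-finitelyGenerated noetherian k (tail g) (N ∩ Span (tail g))
                (∩-isSubmodule N-sub (span-isSubmodule (tail g))) proj₂
      l : ℕ
      l = proj₁ N′-fg
      ys : Vector M.Carrierᴹ l
      ys = proj₁ (proj₂ N′-fg)
      gens∈N : ∀ i → (xs ++ ys) i ∈ N
      gens∈N i with splitAt m i
      ... | inj₁ j = xs∈N j
      ... | inj₂ j = proj₁ (proj₁ (proj₂ (proj₂ N′-fg)) j)
      generate : ∀ x → x ∈ N → Span (xs ++ ys) x
      generate x x∈N =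
        let (c , x≈) = N⊆ x∈N
            x~ : Congruent (head g) (tail g) (head c) x
            x~ = _ , (tail c , M.≈ᴹ-refl) , x≈
            (e , c₀≈) = proj₂ (proj₂ (proj₂ I-fg)) (head c) (x , x∈N , x~)
            -- An element of `N` with the same coefficient at `head g` as `x`; the difference lies
            -- in `N` and in the span of `tail g`, where the induction applies.
            x′ = linComb M e xs
            x′~ = congruent-linComb (head g) (tail g) e (λ i → proj₂ (proj₂ (as∈I i)))
            difference∈ = congruent-difference (head g) (tail g)
                            (congruent-resp _ _ c₀≈ x~) x′~
            (d , x-x′≈) = proj₂ (proj₂ (proj₂ N′-fg)) (x M.+ᴹ (M.-ᴹ x′))
              (N.+-closed x∈N (neg-closed N-sub (linComb-∈ N-sub e xs∈N)) , difference∈)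
        in e ++ d , (begin
          x                                     ≈⟨ GroupOf.//-rightDividesˡ M x′ x ⟨
          (x M.+ᴹ (M.-ᴹ x′)) M.+ᴹ x′            ≈⟨ M.+ᴹ-congʳ x-x′≈ ⟩
          linComb M d ys M.+ᴹ x′                ≈⟨ M.+ᴹ-comm _ _ ⟩
          x′ M.+ᴹ linComb M d ys                ≈⟨ linComb-++ e d xs ys ⟨
          linComb M (e ++ d) (xs ++ ys)         ∎)

  hom-linComb : {A B : Mod} (f : Hom A B) → ∀ {k} (c : Vector R.Carrier k) (g : Vector (Carrierᴹ A) k) →
                LeftModule._≈ᴹ_ B (⟦ f ⟧ (linComb A c g)) (linComb B c (⟦ f ⟧ ∘ g))
  hom-linComb f {zero}  c g = HomProperties.0ᴹ-homo f
  hom-linComb {B = B} f {suc k} c g = B.≈ᴹ-trans (F.+ᴹ-homo _ _)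
    (B.+ᴹ-cong (F.*ₗ-homo _ _) (hom-linComb f (tail c) (tail g)))
    where
    module B = LeftModule B
    module F = HomProperties f

  -- Here the noetherian condition enters: kernels of covers and pullbacks must be finitely
  -- generated to be objects of ℳ.
  finitelyGenerated-Ker : LeftNoetherian R → {A B : Mod} (f : Hom A B) →
                          FinitelyGenerated A → FinitelyGenerated (Ker f)
  finitelyGenerated-Ker noetherian {A} {B} f (k , g , _ , generate) =
    let (m , xs , xs∈ , generateKer) =
          submodule-finitelyGenerated A noetherian k g (λ x → ⟦ f ⟧ x B.≈ᴹ B.0ᴹ)
            ker-isSubmodule (λ {x} _ → generate x _)
        gens = λ i → xs i , xs∈ i
    in m , gens , (λ _ → _) , λ { (x , fx≈0) _ →
         let (c , x≈) = generateKer x fx≈0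
         in c , A.≈ᴹ-trans x≈ (A.≈ᴹ-sym (hom-linComb (kerInclusion f) c gens)) }
    where
    module A = LeftModule A
    module B = LeftModule B
    ker-isSubmodule : IsSubmodule A (λ x → ⟦ f ⟧ x B.≈ᴹ B.0ᴹ)
    ker-isSubmodule = record
      { ∈-resp-≈ = λ x≈y fx≈0 → B.≈ᴹ-trans (HomProperties.⟦⟧-cong f (A.≈ᴹ-sym x≈y)) fx≈0
      ; 0∈       = HomProperties.0ᴹ-homo f
      ; +-closed = λ fx fy → proj₂ (LeftModule._+ᴹ_ (Ker f) (_ , fx) (_ , fy))
      ; *-closed = λ r fx → proj₂ (LeftModule._*ₗ_ (Ker f) r (_ , fx))
      }

  finitelyGenerated-Coker : {A B : Mod} (f : Hom A B) →
                            FinitelyGenerated B → FinitelyGenerated (Coker f)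
  finitelyGenerated-Coker f (k , g , _ , generate) =
    k , g , (λ _ → _) , λ x _ → let (c , x≈) = generate x _ in c , ≈⇒≈-Coker f x≈

  finitelyGenerated-⊕ : (A B : Mod) →
                        FinitelyGenerated A → FinitelyGenerated B → FinitelyGenerated (A ⊕ B)
  finitelyGenerated-⊕ A B (k , g , _ , generateA) (l , h , _ , generateB) =
    k + l , (⟦ ι₁ A B ⟧ ∘ g) ++ (⟦ ι₂ A B ⟧ ∘ h) , (λ _ → _) , λ { (x , y) _ →
      let (c , x≈) = generateA x _
          (d , y≈) = generateB y _
      in c ++ d , (begin
        x , y                                             ≈⟨ A.+ᴹ-identityʳ x , B.+ᴹ-identityˡ y ⟨
        ⟦ ι₁ A B ⟧ x AB.+ᴹ ⟦ ι₂ A B ⟧ y                   ≈⟨ AB.+ᴹ-cong (x≈ , B.≈ᴹ-refl) (A.≈ᴹ-refl , y≈) ⟩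
        ⟦ ι₁ A B ⟧ (linComb A c g) AB.+ᴹ ⟦ ι₂ A B ⟧ (linComb B d h)
          ≈⟨ AB.+ᴹ-cong (hom-linComb (ι₁ A B) c g) (hom-linComb (ι₂ A B) d h) ⟩
        linComb (A ⊕ B) c (⟦ ι₁ A B ⟧ ∘ g) AB.+ᴹ linComb (A ⊕ B) d (⟦ ι₂ A B ⟧ ∘ h)
          ≈⟨ linComb-++ (A ⊕ B) c d (⟦ ι₁ A B ⟧ ∘ g) (⟦ ι₂ A B ⟧ ∘ h) ⟨
        linComb (A ⊕ B) (c ++ d) ((⟦ ι₁ A B ⟧ ∘ g) ++ (⟦ ι₂ A B ⟧ ∘ h)) ∎) }
    where
    module A = LeftModule A
    module B = LeftModule B
    module AB = LeftModule (A ⊕ B)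
    open SetoidReasoning AB.≈ᴹ-setoid

  finitelyGenerated-0 : FinitelyGenerated (0Mod {R = R})
  finitelyGenerated-0 = 0 , [] , (λ ()) , λ _ _ → [] , tt

  finitelyGenerated-R : FinitelyGenerated ᵣR
  finitelyGenerated-R = 1 , (R.1# ∷ []) , (λ _ → _) , λ r _ → (r ∷ []) ,
    R.sym (R.trans (R.+-identityʳ _) (R.*-identityʳ r))

-- The category ℳ, covers by objects of 𝒫, and resolutions.

module Objects {u : Level} (R : Ring u u) (noetherian : LeftNoetherian R)
               (S : Pred (Ring.Carrier R) u) (isOre : IsOreSet R S) where
  private
    module R = Ring R
    module S = IsOreSet isOre
    Mod : Set (lsuc u)
    Mod = LeftModule R u u

  open Obj using (mod)

  module _ (M : Mod) where
    private
      module M = LeftModule M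

    *ₗ-annihilates : ∀ r {s x} → s M.*ₗ x M.≈ᴹ M.0ᴹ → (r R.* s) M.*ₗ x M.≈ᴹ M.0ᴹ
    *ₗ-annihilates r {s} {x} sx≈0 =
      M.≈ᴹ-trans (M.*ₗ-assoc r s x) (M.≈ᴹ-trans (M.*ₗ-congˡ sx≈0) (M.*ₗ-zeroʳ r))

  -- The Ore condition gives a common left multiple `r s = s′ t`. It kills `x` through the factor
  -- `s`, kills `y` through `t`, and lies in `S` as the product `s′ t`.
  common-annihilator : (A B : Mod) → IsTorsion A S → IsTorsion B S → IsTorsion (A ⊕ B) S
  common-annihilator A B A-torsion B-torsion (x , y) =
    let (s , s∈S , sx≈0) = A-torsion x
        (t , t∈S , ty≈0) = B-torsion y
        (r , s′ , s′∈S , rs≈s′t) = S.Rf∩Sa-nonempty s∈S t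
    in s′ R.* t , S.*-closed s′∈S t∈S ,
       A.≈ᴹ-trans (A.*ₗ-congʳ (R.sym rs≈s′t)) (*ₗ-annihilates A r sx≈0) , *ₗ-annihilates B s′ ty≈0
    where
    module A = LeftModule A

  zeroObj : Obj R S
  zeroObj = record
    { mod = 0Mod
    ; fg = finitelyGenerated-0 {R = R}
    ; torsion = λ _ → R.1# , S.1∈S , tt
    }

  infixr 7 _⊕ₒ_
  _⊕ₒ_ : Obj R S → Obj R S → Obj R S
  A ⊕ₒ B = record
    { mod = mod A ⊕ mod B
    ; fg = finitelyGenerated-⊕ (mod A) (mod B) (Obj.fg A) (Obj.fg B)
    ; torsion = common-annihilator (mod A) (mod B) (Obj.torsion A) (Obj.torsion B)
    }

  kerObj : (A : Obj R S) {B : Mod} (f : Hom (mod A) B) → Obj R S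
  kerObj A f = record
    { mod = Ker f
    ; fg = finitelyGenerated-Ker noetherian f (Obj.fg A)
    ; torsion = λ { (x , _) → Obj.torsion A x }
    }

  cokerObj : {A : Mod} (B : Obj R S) (f : Hom A (mod B)) → Obj R S
  cokerObj B f = record
    { mod = Coker f
    ; fg = finitelyGenerated-Coker f (Obj.fg B)
    ; torsion = λ x → let (s , s∈S , sx≈0) = Obj.torsion B x in s , s∈S , ≈⇒≈-Coker f sx≈0
    }

  pullbackObj : (A B : Obj R S) {M : Mod} (f : Hom (mod A) M) (g : Hom (mod B) M) → Obj R S
  pullbackObj A B f g = kerObj (A ⊕ₒ B) (equalizing f g)

  In𝒫-⊕ : (A B : Obj R S) → In𝒫 R S A → In𝒫 R S B → In𝒫 R S (A ⊕ₒ B)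
  In𝒫-⊕ _ _ = pd≤1-⊕

  In𝒫-zero : In𝒫 R S zeroObj
  In𝒫-zero = pd≤1 projective-0 projective-0 (identitySES 0Mod)

  -- This is R/Rs, since `multiplesOf ᵣR s` is right multiplication by `s`. It is torsion because
  -- the Ore condition moves any `x` into Rs by a left factor from `S`.
  cyclicObj : ∀ {s} → s ∈ S → Obj R S
  cyclicObj {s} s∈S = record
    { mod = Coker (multiplesOf ᵣR s)
    ; fg = finitelyGenerated-Coker (multiplesOf (ᵣR {R = R}) s) (finitelyGenerated-R {R = R})
    ; torsion = λ x →
        let (r , t , t∈S , rs≈tx) = S.Rf∩Sa-nonempty s∈S x
        in t , t∈S , r , R.trans (R.sym rs≈tx) (R.sym (R.+-identityʳ _))
    }

  In𝒫-cyclic : ∀ {s} (s∈S : s ∈ S) → In𝒫 R S (cyclicObj s∈S)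
  In𝒫-cyclic {s} s∈S =
    pd≤1 projective-R projective-R (cokernelSES (multiplesOf ᵣR s) (S.right-regular s∈S))

  module _ (M : Obj R S) where
    private
      module M = LeftModule (mod M)

    -- Only the span of `g` has to be reached, so that generators can be added one at a time.
    record PartialCover {k} (g : Vector M.Carrierᴹ k) : Set (lsuc u) where
      field
        source    : Obj R S
        source∈𝒫  : In𝒫 R S source
        map       : Hom (mod source) (mod M)
        map-reach : ∀ c → ∃[ y ] ⟦ map ⟧ y M.≈ᴹ linComb (mod M) c g

    partialCover : ∀ {k} (g : Vector M.Carrierᴹ k) → PartialCover g
    partialCover {zero} g = record
      { source = zeroObj
      ; source∈𝒫 = In𝒫-zero
      ; map = fromZero (mod M)
      ; map-reach = λ _ → tt , M.≈ᴹ-refl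
      }
    partialCover {suc k} g = record
      { source = cyclicObj s∈S ⊕ₒ source
      ; source∈𝒫 = In𝒫-⊕ (cyclicObj s∈S) source (In𝒫-cyclic s∈S) source∈𝒫
      ; map = (first ∘ₕ π₁ (mod (cyclicObj s∈S)) (mod source)) +ₕ
              (map ∘ₕ π₂ (mod (cyclicObj s∈S)) (mod source))
      -- An element of R/Rs is represented by an element of R, so `head c` itself is the preimage of
      -- the first summand.
      ; map-reach = λ c →
          let (y , φy≈) = map-reach (tail c) in (head c , y) , M.+ᴹ-congˡ φy≈
      }
      where
      open PartialCover (partialCover (tail g))
      annihilator : ∃[ s ] s ∈ S × s M.*ₗ head g M.≈ᴹ M.0ᴹ
      annihilator = Obj.torsion M (head g)
      s : R.Carrier
      s = proj₁ annihilator
      s∈S : s ∈ S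
      s∈S = proj₁ (proj₂ annihilator)
      -- Since `s` kills `head g`, the map r ↦ r · `head g` vanishes on Rs and descends to R/Rs.
      first : Hom (mod (cyclicObj s∈S)) (mod M)
      first = cokerLift (multiplesOf ᵣR s) (multiplesOf (mod M) (head g))
        (λ r → *ₗ-annihilates (mod M) r (proj₂ (proj₂ annihilator)))

    record Cover : Set (lsuc u) where
      field
        N   : Obj R S
        P   : Obj R S
        P∈𝒫 : In𝒫 R S P
        ses : SES (mod N) (mod P) (mod M)

    cover : Cover
    cover = record
      { N = kerObj source map
      ; P = source
      ; P∈𝒫 = source∈𝒫
      ; ses = kernelSES map (λ x →
          let (c , x≈) = proj₂ (proj₂ (proj₂ (Obj.fg M))) x _
              (y , φy≈) = map-reach c
          in y , M.≈ᴹ-trans φy≈ (M.≈ᴹ-sym x≈))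
      }
      where open PartialCover (partialCover (proj₁ (proj₂ (Obj.fg M))))

  open Resolution

  trivialResolution : (M : Obj R S) → Resolution R S 0 M
  trivialResolution M = record
    { N = M
    ; P = []
    ; P∈𝒫 = λ ()
    ; exact = idHom (mod M) , injective⇒exact (idHom (mod M)) (λ _ x≈0 → x≈0) ,
              onto⇒surjective (idHom (mod M)) (λ x → x , LeftModule.≈ᴹ-refl (mod M))
    }

  -- Resolutions grow at the left end: the new first term covers the old `N`, and all old indices
  -- move up by one.
  prepend : ∀ {n M} (ρ : Resolution R S n M) → Cover (N ρ) → Resolution R S (suc n) M
  prepend ρ C = record
    { N = C.N
    ; P = C.P ∷ P ρ
    ; P∈𝒫 = λ { zero → C.P∈𝒫 ; (suc i) → P∈𝒫 ρ i }
    ; exact = splice C.ses (mod ∘ P ρ) (exact ρ)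
    }
    where module C = Cover C

  resolution : ∀ n (M : Obj R S) → Resolution R S n M
  resolution zero    M = trivialResolution M
  resolution (suc n) M = prepend (resolution n M) (cover (N (resolution n M)))

  -- The new left end is isomorphic to the image of the first term in what follows. Taken as a
  -- cokernel, it inherits finite generation and makes sense even if no further term follows.
  truncate : ∀ {n M} → Resolution R S (suc n) M → Resolution R S n M
  truncate {n} ρ = record
    { N = cokerObj (P ρ zero) (proj₁ (exact ρ))
    ; P = tail (P ρ)
    ; P∈𝒫 = P∈𝒫 ρ ∘ suc
    ; exact = descend (proj₁ (exact ρ)) n (mod ∘ tail (P ρ)) (proj₂ (proj₂ (exact ρ)))
    }

  initialSES : ∀ {n M} (ρ : Resolution R S (suc n) M) →
               SES (mod (N ρ)) (mod (P ρ zero)) (mod (N (truncate ρ)))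
  initialSES ρ = cokernelSES (proj₁ (exact ρ))
    (exact⇒injective (proj₁ (exact ρ)) (proj₁ (proj₂ (exact ρ))))

-- The shifted invariant and the induction on the length.

module Shift {u a b : Level} (R : Ring u u) (noetherian : LeftNoetherian R)
             (S : Pred (Ring.Carrier R) u) (isOre : IsOreSet R S)
             (Ω : CommutativeMonoid a b) where
  open Objects R noetherian S isOre
  open Obj using (mod)
  open CommutativeMonoid Ω
  open CommutativeSemigroupProperties commutativeSemigroup using (x∙yz≈y∙xz; xy∙z≈y∙xz)
  open MonoidSum monoid using (sum-cong-≋)
  open MonoidMult monoid using (×-congʳ)
  open SetoidReasoning setoid

  private
    Unit : Carrier → Set (a ⊔ b)
    Unit = IsUnit R S Ω

  unit-cancel : ∀ {x} → Unit x → ∀ {y z} → x ∙ y ≈ x ∙ z → y ≈ z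
  unit-cancel {x} (x⁻¹ , x⁻¹x≈ε , _) {y} {z} xy≈xz = begin
    y                 ≈⟨ cancel y ⟨
    x⁻¹ ∙ (x ∙ y)     ≈⟨ ∙-congˡ xy≈xz ⟩
    x⁻¹ ∙ (x ∙ z)     ≈⟨ cancel z ⟩
    z                 ∎
    where
    cancel : ∀ w → x⁻¹ ∙ (x ∙ w) ≈ w
    cancel w = trans (sym (assoc _ _ _)) (trans (∙-congʳ x⁻¹x≈ε) (identityˡ w))

  inverse-unit : ∀ {x y} → x ∙ y ≈ ε → Unit y
  inverse-unit {x} xy≈ε = x , xy≈ε , trans (comm _ _) xy≈ε

  -- The inverse stored in a proof of invertibility is arbitrary data; uniqueness of inverses
  -- identifies it with the given partner, for either sign of the exponent.
  unitPower-neg : ∀ {x y} (x-unit : Unit x) (y-unit : Unit y) → x ∙ y ≈ ε → ∀ z →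
                  unitPower R S Ω x x-unit z ≈ unitPower R S Ω y y-unit (ℤ.- z)
  unitPower-neg _ _ _ (+ zero) = refl
  unitPower-neg {x} {y} _ y-unit@(y⁻¹ , _ , yy⁻¹≈ε) xy≈ε (+ suc k) = ×-congʳ (suc k)
    (unit-cancel y-unit (trans (comm y x) (trans xy≈ε (sym yy⁻¹≈ε))))
  unitPower-neg x-unit@(_ , _ , xx⁻¹≈ε) _ xy≈ε -[1+ k ] = ×-congʳ (suc k)
    (unit-cancel x-unit (trans xx⁻¹≈ε (sym xy≈ε)))

  -- The left exponents are those of the tail of a resolution, one step ahead of those on the right;
  -- the extra sign is absorbed by passing to inverses.
  alternating : ∀ {n} (x y : Vector Carrier n)
                (x-unit : ∀ i → Unit (x i)) (y-unit : ∀ i → Unit (y i)) →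
                (∀ i → y i ∙ x i ≈ ε) →
                MonoidSum.sum monoid (λ i → unitPower R S Ω (x i) (x-unit i) (-1ℤ ℤ.^ suc (suc (toℕ i))))
                ≈ MonoidSum.sum monoid (λ i → unitPower R S Ω (y i) (y-unit i) (-1ℤ ℤ.^ suc (toℕ i)))
  alternating x y x-unit y-unit yx≈ε = sum-cong-≋ λ i → trans
    (reflexive (≡.cong (unitPower R S Ω (x i) (x-unit i)) (ℤ.-1*i≡-i (-1ℤ ℤ.^ suc (toℕ i)))))
    (sym (unitPower-neg (y-unit i) (x-unit i) (yx≈ε i) (-1ℤ ℤ.^ suc (toℕ i))))

  unit-transpose : ∀ {x y z} (x-unit : Unit x) → x ∙ y ≈ z → proj₁ x-unit ∙ z ≈ y
  unit-transpose (x⁻¹ , x⁻¹x≈ε , _) xy≈z = trans (∙-congˡ (sym xy≈z))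
    (trans (sym (assoc _ _ _)) (trans (∙-congʳ x⁻¹x≈ε) (identityˡ _)))

  regroup : ∀ {v w z} r → v ∙ w ≈ z → (v ∙ r) ∙ w ≈ r ∙ z
  regroup r vw≈z = trans (xy∙z≈y∙xz _ r _) (∙-congˡ vw≈z)

  -- Needed because the shift of F by n + 1 and the shift of F¹ by n are computed from different
  -- resolutions and agree only up to `≈`.
  fitting-resp-≈ : {F G : Obj R S → Carrier} → (∀ M → F M ≈ G M) →
                   IsFittingInvariant R S Ω F → IsFittingInvariant R S Ω G
  fitting-resp-≈ F≈G F-fitting = record
    { unit = λ P P∈𝒫 →
        let (v , v∙F≈ε , F∙v≈ε) = unit P P∈𝒫
        in v , trans (∙-congˡ (sym (F≈G P))) v∙F≈ε , trans (∙-congʳ (sym (F≈G P))) F∙v≈ε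
    ; additive = λ {M′} {M} {P} exact P∈𝒫 →
        trans (sym (F≈G M)) (trans (additive exact P∈𝒫) (∙-cong (F≈G P) (F≈G M′)))
    }
    where open IsFittingInvariant F-fitting

  module _ {F : Obj R S → Carrier} (F-fitting : IsFittingInvariant R S Ω F) where
    open IsFittingInvariant F-fitting

    additive-SES : ∀ M′ M P → SES (mod M′) (mod M) (mod P) → In𝒫 R S P → F M ≈ F P ∙ F M′
    additive-SES M′ M P E = additive {M′} {M} {P} (toExactSequence (mod M ∷ []) E)

    -- Additivity on the zero sequence makes F(0) idempotent, and F(0) is a unit.
    F-zero : F zeroObj ≈ ε
    F-zero = unit-cancel (unit zeroObj In𝒫-zero)
      (trans (sym (additive-SES zeroObj zeroObj zeroObj (identitySES 0Mod) In𝒫-zero)) (sym (identityʳ _)))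

    -- Invariance under isomorphism is not an axiom; it is additivity on 0 → N → M → 0 → 0.
    F-iso : ∀ M N (f : Hom (mod N) (mod M)) → IsInjective f → IsOnto f → F N ≈ F M
    F-iso M N f f-inj f-onto = begin
      F N              ≈⟨ identityˡ _ ⟨
      ε ∙ F N          ≈⟨ ∙-congʳ F-zero ⟨
      F zeroObj ∙ F N  ≈⟨ additive-SES N M zeroObj (isoSES f f-inj f-onto) In𝒫-zero ⟨
      F M              ∎

    F¹ : Obj R S → Carrier
    F¹ M = proj₁ (unit C.P C.P∈𝒫) ∙ F C.N
      where module C = Cover (cover M)

    -- F of the pullback equals both F(P) F(N₀) and F(P₀) F(N), where N₀ and P₀ belong to the chosen
    -- cover. This equation is all that the induction needs to know about F¹.
    F¹-cover : ∀ M (C : Cover M) → F (Cover.P C) ∙ F¹ M ≈ F (Cover.N C)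
    F¹-cover M C = begin
      F C.P ∙ (v ∙ F C₀.N)     ≈⟨ x∙yz≈y∙xz _ _ _ ⟩
      v ∙ (F C.P ∙ F C₀.N)     ≈⟨ ∙-congˡ (additive-SES C₀.N X C.P (pullback-kernel C₀.ses (SES.proj C.ses) Q) C.P∈𝒫) ⟨
      v ∙ F X                  ≈⟨ ∙-congˡ (additive-SES C.N X C₀.P (pullback-kernel C.ses (SES.proj C₀.ses) (swap Q)) C₀.P∈𝒫) ⟩
      v ∙ (F C₀.P ∙ F C.N)     ≈⟨ assoc _ _ _ ⟨
      (v ∙ F C₀.P) ∙ F C.N     ≈⟨ ∙-congʳ (proj₁ (proj₂ (unit C₀.P C₀.P∈𝒫))) ⟩
      ε ∙ F C.N                ≈⟨ identityˡ _ ⟩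
      F C.N                    ∎
      where
      module C = Cover C
      module C₀ = Cover (cover M)
      v : Carrier
      v = proj₁ (unit C₀.P C₀.P∈𝒫)
      Q : Pullback (SES.proj C₀.ses) (SES.proj C.ses)
      Q = pullback (SES.proj C₀.ses) (SES.proj C.ses)
      X : Obj R S
      X = pullbackObj C₀.P C.P (SES.proj C₀.ses) (SES.proj C.ses)

    F¹-inverse : ∀ P → In𝒫 R S P → F P ∙ F¹ P ≈ ε
    F¹-inverse P P∈𝒫 = trans
      (F¹-cover P (record { N = zeroObj ; P = P ; P∈𝒫 = P∈𝒫 ; ses = identitySES (mod P) })) F-zero

    F¹-fitting : IsFittingInvariant R S Ω F¹
    F¹-fitting = record
      { unit = λ P P∈𝒫 → inverse-unit (F¹-inverse P P∈𝒫)
      ; additive = λ {M′} {M} {P} exact P∈𝒫 →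
          additive¹ M′ M P (fromExactSequence (mod M ∷ []) exact) P∈𝒫
      }
      where
      additive¹ : ∀ M′ M P → SES (mod M′) (mod M) (mod P) → In𝒫 R S P → F¹ M ≈ F¹ P ∙ F¹ M′
      additive¹ M′ M P E P∈𝒫 = unit-cancel (unit P P∈𝒫) (begin
        F P ∙ F¹ M              ≈⟨ unit-cancel (unit K K∈𝒫) K-cancelled ⟩
        F¹ M′                   ≈⟨ identityˡ _ ⟨
        ε ∙ F¹ M′               ≈⟨ ∙-congʳ (F¹-inverse P P∈𝒫) ⟨
        (F P ∙ F¹ P) ∙ F¹ M′    ≈⟨ assoc _ _ _ ⟩
        F P ∙ (F¹ P ∙ F¹ M′)    ∎)
        where
        module C = Cover (cover M)
        p : Hom (mod C.P) (mod M)
        p = SES.proj C.ses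
        Q : Pullback p (SES.inj E)
        Q = pullback p (SES.inj E)
        K : Obj R S
        K = pullbackObj C.P M′ p (SES.inj E)
        K-ses : SES (mod K) (mod C.P) (mod P)
        K-ses = pullback-cokernel E p (SES.proj-onto C.ses) Q
        K∈𝒫 : In𝒫 R S K
        K∈𝒫 = pd≤1-kernel K-ses C.P∈𝒫 P∈𝒫
        K-cancelled : F K ∙ (F P ∙ F¹ M) ≈ F K ∙ F¹ M′
        -- The cover `C.P` of M and the cover `K` of M′ share the kernel `C.N`, and F(C.P) = F(P)
        -- F(K).
        K-cancelled = begin
          F K ∙ (F P ∙ F¹ M)    ≈⟨ assoc _ _ _ ⟨
          (F K ∙ F P) ∙ F¹ M    ≈⟨ ∙-congʳ (comm _ _) ⟩
          (F P ∙ F K) ∙ F¹ M    ≈⟨ ∙-congʳ (additive-SES K C.P P K-ses P∈𝒫) ⟨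
          F C.P ∙ F¹ M          ≈⟨ F¹-cover M (cover M) ⟩
          F C.N                 ≈⟨ F¹-cover M′ (record
            { N = C.N ; P = K ; P∈𝒫 = K∈𝒫 ; ses = pullback-kernel C.ses (SES.inj E) Q }) ⟨
          F K ∙ F¹ M′           ∎

    -- A resolution of length 0 is an isomorphism N ≅ M, not necessarily the identity.
    value-zero : ∀ {M} (ρ : Resolution R S 0 M) → value R S Ω F F-fitting ρ ≈ F M
    value-zero {M} ρ = trans (identityˡ _)
      (F-iso M (Resolution.N ρ) g (exact⇒injective g (proj₁ (proj₂ (Resolution.exact ρ))))
               (surjective⇒onto g (proj₂ (proj₂ (Resolution.exact ρ)))))
      where
      g : Hom (mod (Resolution.N ρ)) (mod M)
      g = proj₁ (Resolution.exact ρ)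

  module _ {F G : Obj R S → Carrier}
           (F-fitting : IsFittingInvariant R S Ω F) (G-fitting : IsFittingInvariant R S Ω G)
           (G-cover : ∀ M (C : Cover M) → F (Cover.P C) ∙ G M ≈ F (Cover.N C)) where
    private
      module F = IsFittingInvariant F-fitting
      module G = IsFittingInvariant G-fitting

    G-inverse : ∀ P → In𝒫 R S P → G P ∙ F P ≈ ε
    G-inverse P P∈𝒫 = trans (comm _ _) (trans
      (G-cover P (record { N = zeroObj ; P = P ; P∈𝒫 = P∈𝒫 ; ses = identitySES (mod P) }))
      (F-zero F-fitting))

    -- The factor F(P₁)⁻¹ joins F(N) to form G of the cokernel of N → P₁; each remaining power of F
    -- is the opposite power of its inverse G.
    value-suc : ∀ {n M} (ρ : Resolution R S (suc n) M) →
                value R S Ω F F-fitting ρ ≈ value R S Ω G G-fitting (truncate ρ)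
    value-suc ρ = trans
      -- The first exponent computes to -1, and `1 times x⁻¹` unfolds to `x⁻¹ ∙ ε`.
      (∙-congʳ (∙-cong (identityʳ _) (alternating (F ∘ tail P) (G ∘ tail P)
        (λ i → F.unit (P (suc i)) (P∈𝒫 (suc i))) (λ i → G.unit (P (suc i)) (P∈𝒫 (suc i)))
        (λ i → G-inverse (P (suc i)) (P∈𝒫 (suc i))))))
      (regroup _ (unit-transpose (F.unit (P zero) (P∈𝒫 zero))
        (G-cover (Resolution.N (truncate ρ)) first)))
      where
      open Resolution ρ
      first : Cover (Resolution.N (truncate ρ))
      first = record { N = N ; P = P zero ; P∈𝒫 = P∈𝒫 zero ; ses = initialSES ρ }

    module _ {n : ℕ} (G-wellDefined : WellDefined R S Ω G G-fitting n) where
      private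
        module W = WellDefined G-wellDefined

      wellDefined-suc : WellDefined R S Ω F F-fitting (suc n)
      wellDefined-suc = record
        { resolution = resolution (suc n)
        ; independent = λ ρ σ → begin
            value R S Ω F F-fitting ρ              ≈⟨ value-suc ρ ⟩
            value R S Ω G G-fitting (truncate ρ)   ≈⟨ W.independent (truncate ρ) (truncate σ) ⟩
            value R S Ω G G-fitting (truncate σ)   ≈⟨ value-suc σ ⟨
            value R S Ω F F-fitting σ              ∎
        }

      -- Truncating the chosen resolution of length n + 1 need not give the one chosen for length n;
      -- independence for `G` bridges the gap.
      shift-suc : ∀ M → shift R S Ω G G-fitting n G-wellDefined M ≈
                        shift R S Ω F F-fitting (suc n) wellDefined-suc M
      shift-suc M = trans (W.independent (W.resolution M) (truncate (resolution (suc n) M)))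
                          (sym (value-suc (resolution (suc n) M)))

  wellDefined-zero : {F : Obj R S → Carrier} (F-fitting : IsFittingInvariant R S Ω F) →
                     WellDefined R S Ω F F-fitting 0
  wellDefined-zero F-fitting = record
    { resolution = trivialResolution
    ; independent = λ ρ σ → trans (value-zero F-fitting ρ) (sym (value-zero F-fitting σ))
    }

  shift-fitting : ∀ n (F : Obj R S → Carrier) (F-fitting : IsFittingInvariant R S Ω F) →
                  Σ (WellDefined R S Ω F F-fitting n) λ wellDefined →
                    IsFittingInvariant R S Ω (shift R S Ω F F-fitting n wellDefined)
  shift-fitting zero F F-fitting =
    wellDefined-zero F-fitting ,
    fitting-resp-≈ (λ M → sym (value-zero F-fitting (trivialResolution M))) F-fitting
  shift-fitting (suc n) F F-fitting =
    let (G-wellDefined , shift-G-fitting) = shift-fitting n (F¹ F-fitting) (F¹-fitting F-fitting)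
    in wellDefined-suc F-fitting (F¹-fitting F-fitting) (F¹-cover F-fitting) G-wellDefined ,
       fitting-resp-≈
         (shift-suc F-fitting (F¹-fitting F-fitting) (F¹-cover F-fitting) G-wellDefined)
         shift-G-fitting

theorem2p6 : ∀ {u a b} (R : Ring u u) →
    LeftNoetherian R → RightNoetherian R →
    (S : Pred (Ring.Carrier R) u) → IsOreSet R S →
    (Ω : CommutativeMonoid a b) →
    (F : Obj R S → CommutativeMonoid.Carrier Ω) →
    (isFitting : IsFittingInvariant R S Ω F) →
    (n : ℕ) →
    Σ (WellDefined R S Ω F isFitting n) λ wellDefined →
    IsFittingInvariant R S Ω (shift R S Ω F isFitting n wellDefined)
theorem2p6 R noetherian _ S isOre Ω F isFitting n =
  Shift.shift-fitting R noetherian S isOre Ω n F isFitting
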